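{- Let $\pi=(\pi_1,\dots,\pi_n)$ and $\lambda=(\lambda_1,\dots,\lambda_n)$ be partitions with at most $n$ parts such that $\lambda\not\subseteq\pi$ (i.e. $\lambda_i>\pi_i$ for some $i$). Then $W_\lambda(q^\pi t^{\delta(n)};q,p,t,a,b)=0$.
   Context: Fix $|p|<1$; parameters generic. $E(x)=(x;p)_\infty(p/x;p)_\infty$. For integer $m\ge0$, $(a)_m=\prod_{k=0}^{m-1}E(aq^k)$, for $m<0$, $(a)_m=1/(aq^m)_{ -m}$; for a partition $\lambda$ with $n$ parts $(a)_\lambda=\prod_{i=1}^n(at^{1-i})_{\lambda_i}$; several arguments denote products; integer subscripts denote the single-integer symbol. $q^\pi t^{\delta(n)}=(q^{\pi_1}t^{n-1},q^{\pi_2}t^{n-2},\dots,q^{\pi_n})$. For $n$-part partitions with $\lambda_1\ge\mu_1\ge\dots\ge\lambda_n\ge\mu_n$, $\lambda_{n+1}=\mu_{n+1}=0$, $H_{\lambda/\mu}(q,p,t,b)=\prod_{1\le i<j\le n}\Big\{\frac{(q^{\mu_i-\mu_{j-1}}t^{j-i})_{\mu_{j-1}-\lambda_j}(q^{\lambda_i+\lambda_j}t^{3-j-i}b)_{\mu_{j-1}-\lambda_j}}{(q^{\mu_i-\mu_{j-1}+1}t^{j-i-1})_{\mu_{j-1}-\lambda_j}(q^{\lambda_i+\lambda_j+1}t^{2-j-i}b)_{\mu_{j-1}-\lambda_j}}\frac{(q^{\lambda_i-\mu_{j-1}+1}t^{j-i-1})_{\mu_{j-1}-\lambda_j}}{(q^{\lambda_i-\mu_{j-1}}t^{j-i})_{\mu_{j-1}-\lambda_j}}\Big\}\prod_{1\le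 i<j-1\le n}\frac{(q^{\mu_i+\lambda_j+1}t^{1-j-i}b)_{\mu_{j-1}-\lambda_j}}{(q^{\mu_i+\lambda_j}t^{2-j-i}b)_{\mu_{j-1}-\lambda_j}}$; for $x\in\mathbb{C}$, $W_{\lambda/\mu}(x;q,p,t,a,b)=H_{\lambda/\mu}\frac{(x^{ -1},ax)_\lambda(qbx/t,qb/(axt))_\mu}{(x^{ -1},ax)_\mu(qbx,qb/(ax))_\lambda}\prod_{i=1}^n\frac{E(bt^{1-2i}q^{2\mu_i})}{E(bt^{1-2i})}\frac{(bt^{1-2i})_{\mu_i+\lambda_{i+1}}}{(bqt^{ -2i})_{\mu_i+\lambda_{i+1}}}t^{i(\mu_i-\lambda_{i+1})}$ (zero if the interlacing fails); recursively $W_{\lambda/\mu}(y,z_1,\dots,z_\ell;q,p,t,a,b)=\sum_\nu W_{\lambda/\nu}(yt^{ -\ell};q,p,t,at^{2\ell},bt^\ell)W_{\nu/\mu}(z_1,\dots,z_\ell;q,p,t,a,b)$ over $\nu$ with $\lambda_1\ge\nu_1\ge\dots\ge\lambda_n\ge\nu_n\ge0$; $W_\lambda=W_{\lambda/0}$ where $0=(0,\dots,0)$. -}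

module Defs where

open import Algebra.Bundles using (CommutativeRing)
import Algebra.Properties.CommutativeSemigroup as CommutativeSemigroupProperties
open import Algebra.Structures using (IsCommutativeRing)
open import Data.Bool.Base using (if_then_else_)
open import Data.Fin.Base as Fin using (Fin)
open import Data.Fin.Properties using (all?)
open import Data.Integer.Base as ℤ using (ℤ; +_; -[1+_])
import Data.Integer.Properties as ℤ
open import Data.List.Base as List using (List; []; _∷_)
open import Data.Maybe.Base as Maybe using (Maybe; just; nothing)
open import Data.Nat.Base as ℕ using (ℕ; zero; suc)
import Data.Nat.Coprimality as Coprimality
import Data.Nat.Properties as ℕ
open import Data.Product.Base using (Σ-syntax; ∃-syntax; _×_; _,_; proj₁; proj₂)
open import Data.Rational.Base as ℚ using (ℚ; mkℚ; 0ℚ; 1ℚ; ½)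
import Data.Rational.Properties as ℚ
import Data.Rational.Unnormalised.Base as ℚᵘ
import Data.Rational.Unnormalised.Properties as ℚᵘ
open import Data.Sum.Base using (_⊎_; inj₁; inj₂)
open import Data.Unit.Base using (⊤)
open import Data.Vec.Base as Vec using (Vec; []; _∷_)
open import Data.Vec.Relation.Unary.Linked using (Linked)
open import Level using (0ℓ)
open import Relation.Binary.Structures using (IsEquivalence)
open import Relation.Binary.PropositionalEquality
open import Relation.Nullary.Decidable using (Dec; yes; no; does; _×-dec_)
open import Tactic.RingSolver using (solve-∀)
open import Tactic.RingSolver.Core.AlmostCommutativeRing
  using (AlmostCommutativeRing; fromCommutativeRing)

private
  ℚ-acr : AlmostCommutativeRing 0ℓ 0ℓ
  ℚ-acr = fromCommutativeRing ℚ.+-*-commutativeRing isZero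
    where
    isZero : (x : ℚ) → Maybe (0ℚ ≡ x)
    isZero x with 0ℚ ℚ.≟ x
    ... | yes e = just e
    ... | no  _ = nothing

module ℚ-Estimates where
  open import Data.Rational.Base
  open import Data.Rational.Properties

  fromℕ : ℕ → ℚ
  fromℕ n = mkℚ (+ n) 0 (Coprimality.sym (Coprimality.1-coprimeTo n))

  fromℕ-suc : ∀ n → fromℕ (suc n) ≡ 1ℚ + fromℕ n
  fromℕ-suc n = toℚᵘ-injective (ℚᵘ.≃-trans
    (ℚᵘ.*≡* (cong (ℤ._* + 1) (sym (cong₂ ℤ._+_ {x = + 1} refl (ℤ.*-identityʳ (+ n))))))
    (ℚᵘ.≃-sym (toℚᵘ-homo-+ 1ℚ (fromℕ n))))

  ≤fromℕ : ∀ x → ∃[ n ] x ≤ fromℕ n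
  ≤fromℕ (mkℚ (+ n) d _)      = n , *≤* (ℤ.*-monoˡ-≤-nonNeg (+ n) (ℤ.+≤+ (ℕ.s≤s ℕ.z≤n)))
  ≤fromℕ (mkℚ (-[1+ n ]) d _) = 0 , *≤* ℤ.-≤+

  0≤fromℕ : ∀ n → 0ℚ ≤ fromℕ n
  0≤fromℕ n = nonNegative⁻¹ (fromℕ n)

  0≤1 : 0ℚ ≤ 1ℚ
  0≤1 = nonNegative⁻¹ 1ℚ

  +-nonNeg : ∀ {x y} → 0ℚ ≤ x → 0ℚ ≤ y → 0ℚ ≤ x + y
  +-nonNeg = +-mono-≤

  *-monoʳ : ∀ {x y z} → 0ℚ ≤ x → y ≤ z → x * y ≤ x * z
  *-monoʳ {x} 0≤x = *-monoˡ-≤-nonNeg x {{nonNegative 0≤x}}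

  *-monoˡ : ∀ {x y z} → 0ℚ ≤ z → x ≤ y → x * z ≤ y * z
  *-monoˡ {z = z} 0≤z = *-monoʳ-≤-nonNeg z {{nonNegative 0≤z}}

  *-nonNeg : ∀ {x y} → 0ℚ ≤ x → 0ℚ ≤ y → 0ℚ ≤ x * y
  *-nonNeg {x} 0≤x 0≤y = ≤-trans (≤-reflexive (sym (*-zeroʳ x))) (*-monoʳ 0≤x 0≤y)

  *-mono : ∀ {w x y z} → 0ℚ ≤ w → 0ℚ ≤ z → w ≤ x → y ≤ z → w * y ≤ x * z
  *-mono 0≤w 0≤z w≤x y≤z = ≤-trans (*-monoʳ 0≤w y≤z) (*-monoˡ 0≤z w≤x)

  *-pos : ∀ {x y} → 0ℚ < x → 0ℚ < y → 0ℚ < x * y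
  *-pos {x} {y} 0<x 0<y = positive⁻¹ (x * y)
    {{pos*pos⇒pos x {{positive 0<x}} y {{positive 0<y}}}}

  ½-pos : ∀ {ε} → 0ℚ < ε → 0ℚ < ½ * ε
  ½-pos = *-pos (positive⁻¹ ½)

  halves : ∀ ε → ½ * ε + ½ * ε ≡ ε
  halves = solve-∀ ℚ-acr

  split : ∀ {x y ε} → x ≤ ½ * ε → y ≤ ½ * ε → x + y ≤ ε
  split {ε = ε} x≤ y≤ = ≤-trans (+-mono-≤ x≤ y≤) (≤-reflexive (halves ε))

  divide : ∀ {x y} → 0ℚ < x → ∃[ z ] x * z ≡ y
  divide {x} {y} 0<x = 1/x * y , (begin
    x * (1/x * y)  ≡⟨ *-assoc x 1/x y ⟨
    x * 1/x * y    ≡⟨ cong (_* y) (*-inverseʳ x {{x≢0}}) ⟩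
    1ℚ * y         ≡⟨ *-identityˡ y ⟩
    y              ∎)
    where
    open ≡-Reasoning
    x≢0 = pos⇒nonZero x {{positive 0<x}}
    1/x = (1/ x) {{x≢0}}

  dividePos : ∀ {x y} → 0ℚ < x → 0ℚ < y → ∃[ z ] 0ℚ < z × x * z ≡ y
  dividePos {x} {y} 0<x 0<y = let z , e = divide {x} {y} 0<x in
    z , *-cancelˡ-<-nonNeg x {{nonNegative (<⇒≤ 0<x)}}
          (subst₂ _<_ (sym (*-zeroʳ x)) (sym e) 0<y) , e

  archimedes : ∀ x {y} → 0ℚ < y → ∃[ n ] x ≤ fromℕ n * y
  archimedes x {y} 0<y = let z , e = divide {y} {x} 0<y; n , z≤n = ≤fromℕ z in
    n , ≤-trans (≤-reflexive (sym e)) (≤-trans (*-monoʳ (<⇒≤ 0<y) z≤n) (≤-reflexive (*-comm y _)))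

  positiveBound : ∀ x → ∃[ y ] 0ℚ < y × x ≤ y
  positiveBound x = let n , x≤n = ≤fromℕ x in
    fromℕ (suc n) , positive⁻¹ _ ,
    ≤-trans x≤n (≤-trans (≤-reflexive (sym (+-identityˡ _)))
      (≤-trans (+-monoˡ-≤ (fromℕ n) 0≤1) (≤-reflexive (sym (fromℕ-suc n)))))

  0≤x² : ∀ x → 0ℚ ≤ x * x
  0≤x² x = ≤-trans (0≤∣p∣ (x * x)) (≤-reflexive (go (∣p∣≡p∨∣p∣≡-p x)))
    where
    go : ∣ x ∣ ≡ x ⊎ ∣ x ∣ ≡ - x → ∣ x * x ∣ ≡ x * x
    go (inj₁ e) = trans (∣p*q∣≡∣p∣*∣q∣ x x) (cong₂ _*_ e e)
    go (inj₂ e) = trans (∣p*q∣≡∣p∣*∣q∣ x x) (trans (cong₂ _*_ e e) (lem x))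
      where
      lem : ∀ x → - x * - x ≡ x * x
      lem = solve-∀ ℚ-acr

  ∣x∣²≡x² : ∀ x → ∣ x ∣ * ∣ x ∣ ≡ x * x
  ∣x∣²≡x² x = trans (sym (∣p*q∣≡∣p∣*∣q∣ x x)) (0≤p⇒∣p∣≡p (0≤x² x))

  ≤√ : ∀ {x y} → 0ℚ ≤ x → 0ℚ ≤ y → x * x ≤ y * y → x ≤ y
  ≤√ {x} {y} 0≤x 0≤y x²≤y² = ≮⇒≥ (λ y<x → <-irrefl refl (≤-<-trans x²≤y²
    (≤-<-trans (*-monoʳ 0≤y (<⇒≤ y<x))
      (*-monoˡ-<-pos x {{positive (≤-<-trans 0≤y y<x)}} y<x))))

  ∣-∣-sym : ∀ x y → ∣ x - y ∣ ≡ ∣ y - x ∣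
  ∣-∣-sym x y = trans (cong ∣_∣ (lem x y)) (∣-p∣≡∣p∣ (y - x))
    where
    lem : ∀ x y → x - y ≡ - (y - x)
    lem = solve-∀ ℚ-acr

  triangle : ∀ x y z → ∣ x - z ∣ ≤ ∣ x - y ∣ + ∣ y - z ∣
  triangle x y z = ≤-trans (≤-reflexive (cong ∣_∣ (lem x y z))) (∣p+q∣≤∣p∣+∣q∣ (x - y) (y - z))
    where
    lem : ∀ x y z → x - z ≡ (x - y) + (y - z)
    lem = solve-∀ ℚ-acr

  +-dist : ∀ w x y z → ∣ (w + x) - (y + z) ∣ ≤ ∣ w - y ∣ + ∣ x - z ∣
  +-dist w x y z = ≤-trans (≤-reflexive (cong ∣_∣ (lem w x y z))) (∣p+q∣≤∣p∣+∣q∣ (w - y) (x - z))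
    where
    lem : ∀ w x y z → (w + x) - (y + z) ≡ (w - y) + (x - z)
    lem = solve-∀ ℚ-acr

  neg-dist : ∀ x y → ∣ - x - - y ∣ ≡ ∣ x - y ∣
  neg-dist x y = trans (cong ∣_∣ (lem x y)) (∣-p∣≡∣p∣ (x - y))
    where
    lem : ∀ x y → - x - - y ≡ - (x - y)
    lem = solve-∀ ℚ-acr

  *-dist : ∀ w x y z → ∣ w * x - y * z ∣ ≤ ∣ w ∣ * ∣ x - z ∣ + ∣ z ∣ * ∣ w - y ∣
  *-dist w x y z = begin
    ∣ w * x - y * z ∣                    ≡⟨ cong ∣_∣ (lem w x y z) ⟩
    ∣ w * (x - z) + z * (w - y) ∣        ≤⟨ ∣p+q∣≤∣p∣+∣q∣ (w * (x - z)) (z * (w - y)) ⟩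
    ∣ w * (x - z) ∣ + ∣ z * (w - y) ∣    ≡⟨ cong₂ _+_ (∣p*q∣≡∣p∣*∣q∣ w _) (∣p*q∣≡∣p∣*∣q∣ z _) ⟩
    ∣ w ∣ * ∣ x - z ∣ + ∣ z ∣ * ∣ w - y ∣ ∎
    where
    open ≤-Reasoning
    lem : ∀ w x y z → w * x - y * z ≡ w * (x - z) + z * (w - y)
    lem = solve-∀ ℚ-acr

  ∣x∣≤∣y∣+∣x-y∣ : ∀ x y → ∣ x ∣ ≤ ∣ y ∣ + ∣ x - y ∣
  ∣x∣≤∣y∣+∣x-y∣ x y = ≤-trans (≤-reflexive (cong ∣_∣ (lem x y))) (∣p+q∣≤∣p∣+∣q∣ y (x - y))
    where
    lem : ∀ x y → x ≡ y + (x - y)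
    lem = solve-∀ ℚ-acr

private
  module Identities where
    open import Data.Rational.Base
    l2 : ∀ a b c d e f → (a * c - b * d) * e - (a * d + b * c) * f ≡ a * (c * e - d * f) - b * (c * f + d * e)
    l2 = solve-∀ ℚ-acr
    l3 : ∀ a b c d e f → (a * c - b * d) * f + (a * d + b * c) * e ≡ a * (c * f + d * e) + b * (c * e - d * f)
    l3 = solve-∀ ℚ-acr
    l4 : ∀ a b → 1ℚ * a - 0ℚ * b ≡ a
    l4 = solve-∀ ℚ-acr
    l5 : ∀ a b → 1ℚ * a + 0ℚ * b ≡ a
    l5 = solve-∀ ℚ-acr
    l6 : ∀ a b → a * 1ℚ - b * 0ℚ ≡ a
    l6 = solve-∀ ℚ-acr
    l7 : ∀ a b → a * 0ℚ + b * 1ℚ ≡ b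
    l7 = solve-∀ ℚ-acr
    l8 : ∀ a b c d e f → a * (c + e) - b * (d + f) ≡ (a * c - b * d) + (a * e - b * f)
    l8 = solve-∀ ℚ-acr
    l9 : ∀ a b c d e f → a * (d + f) + b * (c + e) ≡ (a * d + b * c) + (a * f + b * e)
    l9 = solve-∀ ℚ-acr
    l10 : ∀ a b c d e f → (c + e) * a - (d + f) * b ≡ (c * a - d * b) + (e * a - f * b)
    l10 = solve-∀ ℚ-acr
    l11 : ∀ a b c d e f → (c + e) * b + (d + f) * a ≡ (c * b + d * a) + (e * b + f * a)
    l11 = solve-∀ ℚ-acr
    l12 : ∀ a b c d → a * c - b * d ≡ c * a - d * b
    l12 = solve-∀ ℚ-acr
    l13 : ∀ a b c d → a * d + b * c ≡ c * b + d * a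
    l13 = solve-∀ ℚ-acr
    quarters : ∀ ε → ½ * (½ * ε) + (½ * ε + ½ * (½ * ε)) ≡ ε
    quarters = solve-∀ ℚ-acr
    eq₁ : ∀ a b c d → (a * c + b * d) + (a * d + b * c) ≡ (a + b) * (c + d)
    eq₁ = solve-∀ ℚ-acr
    eq₂ : ∀ a b c d → (a * c - b * d) * (a * c - b * d) + (a * d + b * c) * (a * d + b * c) ≡ (a * a + b * b) * (c * c + d * d)
    eq₂ = solve-∀ ℚ-acr
    eq₃ : ∀ a b c d → (a + b) + (c + d) ≡ (a + c) + (b + d)
    eq₃ = solve-∀ ℚ-acr
    eq₄ : ∀ t s → (t * t) * (s * s) ≡ (t * s) * (t * s)
    eq₄ = solve-∀ ℚ-acr
    eq₅ : ∀ x y → x * (y + y) ≡ (x + x) * y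
    eq₅ = solve-∀ ℚ-acr
    eq₇ : ∀ ε → ((½ * ε) * (½ * ε) + (½ * ε) * (½ * ε)) + ½ * (ε * ε) ≡ ε * ε
    eq₇ = solve-∀ ℚ-acr
    eq₈ : ∀ ε → (1ℚ - ε) + (½ * ε) * (½ * ε) ≡ (1ℚ - ½ * ε) * (1ℚ - ½ * ε)
    eq₈ = solve-∀ ℚ-acr
    eq₉ : ∀ ε → ½ * ε ≡ 1ℚ - (1ℚ - ½ * ε)
    eq₉ = solve-∀ ℚ-acr
    eq₁₀ : ∀ a ε → a ≡ (a + ε) - ε
    eq₁₀ = solve-∀ ℚ-acr
    eq₁₁ : ∀ ε → (1ℚ - ε) + ½ * ε ≡ 1ℚ - ½ * ε
    eq₁₁ = solve-∀ ℚ-acr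
    eq₁₂ : ∀ a b c d → (a * (1ℚ - c) - b * (0ℚ - d)) - a ≡ - (a * c - b * d)
    eq₁₂ = solve-∀ ℚ-acr
    eq₁₃ : ∀ a b c d → (a * (0ℚ - d) + b * (1ℚ - c)) - b ≡ - (a * d + b * c)
    eq₁₃ = solve-∀ ℚ-acr
    eq₁₄ : ∀ b c → b + b * c ≡ b * (1ℚ + c)
    eq₁₄ = solve-∀ ℚ-acr
    eq₁₅ : ∀ b y → (b + y) - b ≡ y
    eq₁₅ = solve-∀ ℚ-acr
    eq₁₆ : ∀ w b y → (w + b) + y ≡ b + (w + y)
    eq₁₆ = solve-∀ ℚ-acr
    eq₁₇ : ∀ a b c → (a * b) * c ≡ b * (a * c)
    eq₁₇ = solve-∀ ℚ-acr
    eq₁₈ : ∀ a b c d → a * (c * b) - b * (d * a) ≡ (a * b) * (c - d)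
    eq₁₈ = solve-∀ ℚ-acr
    eq₁₉ : ∀ a b r → a * (a * r) - b * - (b * r) ≡ (a * a + b * b) * r
    eq₁₉ = solve-∀ ℚ-acr
    eq₂₀ : ∀ a b r → a * - (b * r) + b * (a * r) ≡ 0ℚ
    eq₂₀ = solve-∀ ℚ-acr

open ℚ-Estimates

-- bound N = ∏_{k<N} (1 + d s^k) dominates the partial products of (x;p)_∞ in
-- the norm ∣ re ∣ + ∣ im ∣, with s an upper bound of ∣ p ∣ below 1.
module Majorant where
  open import Data.Rational.Base
  open import Data.Rational.Properties

  module Bound
    (s d e : ℚ) (0≤s : 0ℚ ≤ s) (s<1 : 0ℚ < 1ℚ - s)
    (0≤d : 0ℚ ≤ d) (0≤e : 0ℚ ≤ e) (he≡d : (1ℚ - s) * e ≡ d) where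

    private
      h : ℚ
      h = 1ℚ - s

    pow : ℕ → ℚ
    pow zero    = 1ℚ
    pow (suc n) = pow n * s

    bound : ℕ → ℚ
    bound zero    = 1ℚ
    bound (suc n) = bound n * (1ℚ + d * pow n)

    0≤pow : ∀ n → 0ℚ ≤ pow n
    0≤pow zero    = 0≤1
    0≤pow (suc n) = *-nonNeg (0≤pow n) 0≤s

    0≤bound : ∀ n → 0ℚ ≤ bound n
    0≤bound zero    = 0≤1
    0≤bound (suc n) = *-nonNeg (0≤bound n) (+-nonNeg 0≤1 (*-nonNeg 0≤d (0≤pow n)))

    s≤1 : s ≤ 1ℚ
    s≤1 = subst₂ _≤_ (+-identityˡ s) (lem s) (+-monoˡ-≤ s (<⇒≤ s<1))
      where
      lem : ∀ s → (1ℚ - s) + s ≡ 1ℚ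
      lem = solve-∀ ℚ-acr

    pow-step : ∀ n → pow (suc n) ≤ pow n
    pow-step n = ≤-trans (*-monoʳ (0≤pow n) s≤1) (≤-reflexive (*-identityʳ (pow n)))

    pow-anti : ∀ i n → pow (i ℕ.+ n) ≤ pow n
    pow-anti zero    n = ≤-refl
    pow-anti (suc i) n = ≤-trans (pow-step (i ℕ.+ n)) (pow-anti i n)

    pow-anti′ : ∀ {m n} → m ℕ.≤ n → pow n ≤ pow m
    pow-anti′ {m} {n} m≤n = subst (λ k → pow k ≤ pow m) (ℕ.m∸n+n≡m m≤n) (pow-anti (n ℕ.∸ m) m)

    private
      eq₂ : ∀ f s P → (1ℚ + f) * ((1ℚ - s) * (P * s)) + P * s ≡ (f * ((1ℚ - s) * P) + (1ℚ - s) * P) * s + P * s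
      eq₂ = solve-∀ ℚ-acr
      eq₃ : ∀ f s P → (f * ((1ℚ - s) * P) + (1ℚ - s) * P) * 1ℚ + P * s ≡ f * ((1ℚ - s) * P) + P
      eq₃ = solve-∀ ℚ-acr
      eq₀ : ∀ s → 0ℚ * ((1ℚ - s) * 1ℚ) + 1ℚ ≡ 1ℚ
      eq₀ = solve-∀ ℚ-acr
      eq₄ : ∀ f y ε P → f * (y * ε) * P ≡ (f * (y * P)) * ε
      eq₄ = solve-∀ ℚ-acr
      eq₅ : ∀ b w y → (b * (1ℚ + w)) * y ≡ b * ((1ℚ + w) * y)
      eq₅ = solve-∀ ℚ-acr
      eq₆ : ∀ s e P k → (1ℚ + (1ℚ - s) * e * P) * ((1ℚ - k) + e * (P * s)) + (1ℚ - s) * e * P * ((1ℚ - s) * e * P + (k - e * P)) ≡ (1ℚ - k) + e * P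
      eq₆ = solve-∀ ℚ-acr
      eq₇ : ∀ b k → b * ((1ℚ - k) + k) ≡ b
      eq₇ = solve-∀ ℚ-acr
      eq₈ : ∀ x → x - x ≡ 0ℚ
      eq₈ = solve-∀ ℚ-acr
      eq₉ : ∀ k P → (1ℚ - k) + P ≡ (½ + P) + (½ - k)
      eq₉ = solve-∀ ℚ-acr
      eq₁₀ : ∀ b → b ≡ (1ℚ + 1ℚ) * (b * ½)
      eq₁₀ = solve-∀ ℚ-acr
      eq₁₁ : ∀ b C s e P → b * (1ℚ + (1ℚ - s) * e * P) + C * (e * (P * s)) ≡ (b + C * (e * (P * s))) + b * ((1ℚ - s) * e * P)
      eq₁₁ = solve-∀ ℚ-acr
      eq₁₂ : ∀ b C s e P → (b + C * (e * (P * s))) + C * ((1ℚ - s) * e * P) ≡ b + C * (e * P)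
      eq₁₂ = solve-∀ ℚ-acr
      ≤+ : ∀ {x y} → 0ℚ ≤ y → x ≤ x + y
      ≤+ {x} 0≤y = ≤-trans (≤-reflexive (sym (+-identityʳ x))) (+-monoʳ-≤ x 0≤y)
      0≤- : ∀ {x y} → x ≤ y → 0ℚ ≤ y - x
      0≤- {x} {y} x≤y = ≤-trans (≤-reflexive (sym (eq₈ x))) (+-monoˡ-≤ (- x) x≤y)

    0≤h : 0ℚ ≤ h
    0≤h = <⇒≤ s<1

    pow-decay : ∀ n → fromℕ n * (h * pow n) + pow n ≤ 1ℚ
    pow-decay zero    = ≤-reflexive (eq₀ s)
    pow-decay (suc n) = begin
      fromℕ (suc n) * (h * (P * s)) + P * s       ≡⟨ cong (λ f → f * (h * (P * s)) + P * s) (fromℕ-suc n) ⟩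
      (1ℚ + fromℕ n) * (h * (P * s)) + P * s      ≡⟨ eq₂ (fromℕ n) s P ⟩
      (fromℕ n * (h * P) + h * P) * s + P * s     ≤⟨ +-monoˡ-≤ (P * s) (*-monoʳ (+-nonNeg (*-nonNeg (0≤fromℕ n) (*-nonNeg 0≤h (0≤pow n))) (*-nonNeg 0≤h (0≤pow n))) s≤1) ⟩
      (fromℕ n * (h * P) + h * P) * 1ℚ + P * s    ≡⟨ eq₃ (fromℕ n) s P ⟩
      fromℕ n * (h * P) + P                       ≤⟨ pow-decay n ⟩
      1ℚ                                          ∎
      where
      open ≤-Reasoning
      P = pow n

    pow→0 : ∀ {X} → 0ℚ ≤ X → ∀ ε → 0ℚ < ε → ∃[ N ] (∀ n → N ℕ.≤ n → X * pow n ≤ ε)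
    pow→0 {X} 0≤X ε 0<ε = let N , X≤ = archimedes X (*-pos s<1 0<ε) in
      N , λ n N≤n → begin
        X * pow n                        ≤⟨ *-monoʳ 0≤X (pow-anti′ N≤n) ⟩
        X * pow N                        ≤⟨ *-monoˡ (0≤pow N) X≤ ⟩
        fromℕ N * (h * ε) * pow N        ≡⟨ eq₄ (fromℕ N) h ε (pow N) ⟩
        fromℕ N * (h * pow N) * ε        ≤⟨ *-monoˡ {fromℕ N * (h * pow N)} {1ℚ} (<⇒≤ 0<ε) (≤-trans (≤+ {fromℕ N * (h * pow N)} {pow N} (0≤pow N)) (pow-decay N)) ⟩
        1ℚ * ε                           ≡⟨ *-identityˡ ε ⟩
        ε                                ∎
      where open ≤-Reasoning

    bound-lemma : ∀ K j → bound (j ℕ.+ K) * ((1ℚ - e * pow K) + e * pow (j ℕ.+ K)) ≤ bound K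
    bound-lemma K zero    = ≤-reflexive (eq₇ (bound K) (e * pow K))
    bound-lemma K (suc j) = begin
      (b * (1ℚ + d * P)) * ((1ℚ - k) + e * (P * s))      ≡⟨ eq₅ b (d * P) _ ⟩
      b * ((1ℚ + d * P) * ((1ℚ - k) + e * (P * s)))      ≤⟨ *-monoʳ (0≤bound (j ℕ.+ K)) step ⟩
      b * ((1ℚ - k) + e * P)                             ≤⟨ bound-lemma K j ⟩
      bound K                                            ∎
      where
      open ≤-Reasoning
      b = bound (j ℕ.+ K)
      P = pow (j ℕ.+ K)
      k = e * pow K
      0≤dP : 0ℚ ≤ d * P
      0≤dP = *-nonNeg 0≤d (0≤pow (j ℕ.+ K))
      step : (1ℚ + d * P) * ((1ℚ - k) + e * (P * s)) ≤ (1ℚ - k) + e * P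
      step = ≤-trans
        (≤+ (*-nonNeg 0≤dP (+-nonNeg 0≤dP (0≤- (*-monoʳ 0≤e (pow-anti j K))))))
        (≤-reflexive (subst (λ d → (1ℚ + d * P) * ((1ℚ - k) + e * (P * s)) + d * P * (d * P + (k - e * P)) ≡ (1ℚ - k) + e * P) he≡d (eq₆ s e P k)))

    K₀ : ∃[ K ] (∀ n → K ℕ.≤ n → e * pow n ≤ ½)
    K₀ = pow→0 0≤e ½ (positive⁻¹ ½)

    K : ℕ
    K = proj₁ K₀

    C : ℚ
    C = (1ℚ + 1ℚ) * bound K

    0≤C : 0ℚ ≤ C
    0≤C = *-nonNeg (+-nonNeg 0≤1 0≤1) (0≤bound K)

    bound≤C : ∀ j → bound (j ℕ.+ K) ≤ C
    bound≤C j = begin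
      bound (j ℕ.+ K)                                      ≡⟨ eq₁₀ _ ⟩
      (1ℚ + 1ℚ) * (bound (j ℕ.+ K) * ½)                    ≤⟨ *-monoʳ (+-nonNeg 0≤1 0≤1) (≤-trans (*-monoʳ (0≤bound (j ℕ.+ K)) ½≤) (bound-lemma K j)) ⟩
      C                                                    ∎
      where
      open ≤-Reasoning
      ½≤ : ½ ≤ (1ℚ - e * pow K) + e * pow (j ℕ.+ K)
      ½≤ = ≤-trans (≤-trans (≤+ (*-nonNeg 0≤e (0≤pow (j ℕ.+ K))))
                            (≤+ (0≤- (proj₂ K₀ K ℕ.≤-refl))))
                   (≤-reflexive (sym (eq₉ (e * pow K) (e * pow (j ℕ.+ K)))))

    bound-growth : ∀ j i → let N = j ℕ.+ K in
      bound (i ℕ.+ N) + C * (e * pow (i ℕ.+ N)) ≤ bound N + C * (e * pow N)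
    bound-growth j zero    = ≤-refl
    bound-growth j (suc i) = begin
      b * (1ℚ + d * P) + C * (e * (P * s))             ≡⟨ cong (λ d → b * (1ℚ + d * P) + C * (e * (P * s))) he≡d ⟨
      b * (1ℚ + h * e * P) + C * (e * (P * s))         ≡⟨ eq₁₁ b C s e P ⟩
      (b + C * (e * (P * s))) + b * (h * e * P)        ≤⟨ +-monoʳ-≤ (b + C * (e * (P * s))) (*-monoˡ (*-nonNeg (*-nonNeg 0≤h 0≤e) (0≤pow (i ℕ.+ N))) b≤C) ⟩
      (b + C * (e * (P * s))) + C * (h * e * P)        ≡⟨ eq₁₂ b C s e P ⟩
      b + C * (e * P)                                  ≤⟨ bound-growth j i ⟩
      bound N + C * (e * pow N)                        ∎
      where
      open ≤-Reasoning
      N = j ℕ.+ K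
      b = bound (i ℕ.+ N)
      P = pow (i ℕ.+ N)
      b≤C : b ≤ C
      b≤C = subst (λ k → bound k ≤ C) (ℕ.+-assoc i j K) (bound≤C (i ℕ.+ j))

    bound-cauchy : ∀ ε → 0ℚ < ε → ∃[ N₀ ] (∀ N → N₀ ℕ.≤ N → ∀ i → bound (i ℕ.+ N) ≤ bound N + ε)
    bound-cauchy ε 0<ε =
      let M , f = pow→0 (*-nonNeg 0≤C 0≤e) ε 0<ε in
      M ℕ.⊔ K , λ N le i →
        let K≤N = ℕ.m⊔n≤o⇒n≤o M K le
            M≤N = ℕ.m⊔n≤o⇒m≤o M K le
        in begin
          bound (i ℕ.+ N)                                  ≤⟨ ≤+ (*-nonNeg 0≤C (*-nonNeg 0≤e (0≤pow (i ℕ.+ N)))) ⟩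
          bound (i ℕ.+ N) + C * (e * pow (i ℕ.+ N))        ≤⟨ subst (λ N → bound (i ℕ.+ N) + C * (e * pow (i ℕ.+ N)) ≤ bound N + C * (e * pow N)) (ℕ.m∸n+n≡m K≤N) (bound-growth (N ℕ.∸ K) i) ⟩
          bound N + C * (e * pow N)                        ≡⟨ cong (λ y → bound N + y) (*-assoc C e (pow N)) ⟨
          bound N + C * e * pow N                          ≤⟨ +-monoʳ-≤ (bound N) (f N M≤N) ⟩
          bound N + ε                                      ∎
      where open ≤-Reasoning

-- Real numbers are Cauchy sequences of rationals; equality is the relation ≈.
Eventually : (ℕ → Set) → Set
Eventually P = ∃[ N ] (∀ n → N ℕ.≤ n → P n)

both : ∀ {P Q : ℕ → Set} → Eventually P → Eventually Q → Eventually (λ n → P n × Q n)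
both (M , f) (N , g) = M ℕ.⊔ N , λ n le →
  f n (ℕ.≤-trans (ℕ.m≤m⊔n M N) le) , g n (ℕ.≤-trans (ℕ.m≤n⊔m M N) le)

IsCauchy : (ℕ → ℚ) → Set
IsCauchy s = ∀ ε → 0ℚ ℚ.< ε →
  ∃[ N ] (∀ m n → N ℕ.≤ m → N ℕ.≤ n → ℚ.∣ s m ℚ.- s n ∣ ℚ.≤ ε)

record ℝ : Set where
  constructor mkℝ
  field
    seq    : ℕ → ℚ
    cauchy : IsCauchy seq

open ℝ public

module Real where

  infix 4 _≈_ _<_
  infixl 6 _+_ _-_
  infixl 7 _*_
  infix 8 -_

  _≈_ : ℝ → ℝ → Set
  x ≈ y = ∀ ε → 0ℚ ℚ.< ε → Eventually (λ n → ℚ.∣ seq x n ℚ.- seq y n ∣ ℚ.≤ ε)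

  _<_ : ℝ → ℝ → Set
  x < y = ∃[ ε ] (0ℚ ℚ.< ε × Eventually (λ n → seq x n ℚ.+ ε ℚ.≤ seq y n))

  fromℚ : ℚ → ℝ
  fromℚ c = mkℝ (λ _ → c) (λ ε 0<ε → 0 , λ _ _ _ _ →
    ℚ.≤-trans (ℚ.≤-reflexive (cong ℚ.∣_∣ (ℚ.+-inverseʳ c))) (ℚ.<⇒≤ 0<ε))

  bounded : ∀ x → ∃[ B ] (0ℚ ℚ.< B × Eventually (λ n → ℚ.∣ seq x n ∣ ℚ.≤ B))
  bounded x =
    let N , c = cauchy x 1ℚ (ℚ.positive⁻¹ 1ℚ)
        B , 0<B , le = positiveBound (ℚ.∣ seq x N ∣ ℚ.+ 1ℚ)
    in B , 0<B , N , λ n N≤n → ℚ.≤-trans (∣x∣≤∣y∣+∣x-y∣ (seq x n) (seq x N))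
         (ℚ.≤-trans (ℚ.+-monoʳ-≤ ℚ.∣ seq x N ∣ (c n N N≤n ℕ.≤-refl)) le)

  abstract
    +-cauchy : ∀ x y → IsCauchy (λ n → seq x n ℚ.+ seq y n)
    +-cauchy x y ε 0<ε =
      let M , f = cauchy x (½ ℚ.* ε) (½-pos 0<ε)
          N , g = cauchy y (½ ℚ.* ε) (½-pos 0<ε)
      in M ℕ.⊔ N , λ m n lm ln → ℚ.≤-trans
           (+-dist (seq x m) (seq y m) (seq x n) (seq y n))
           (split (f m n (ℕ.m⊔n≤o⇒m≤o M N lm) (ℕ.m⊔n≤o⇒m≤o M N ln))
                  (g m n (ℕ.m⊔n≤o⇒n≤o M N lm) (ℕ.m⊔n≤o⇒n≤o M N ln)))

    neg-cauchy : ∀ x → IsCauchy (λ n → ℚ.- seq x n)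
    neg-cauchy x ε 0<ε =
      let N , f = cauchy x ε 0<ε
      in N , λ m n lm ln → ℚ.≤-trans (ℚ.≤-reflexive (neg-dist (seq x m) (seq x n))) (f m n lm ln)

    *-cauchy : ∀ x y → IsCauchy (λ n → seq x n ℚ.* seq y n)
    *-cauchy x y ε 0<ε =
      let A , 0<A , K , a = bounded x
          B , 0<B , L , b = bounded y
          δ , 0<δ , eδ = dividePos 0<A (½-pos 0<ε)
          η , 0<η , eη = dividePos 0<B (½-pos 0<ε)
          M , f = cauchy y δ 0<δ
          N , g = cauchy x η 0<η
          Q = (K ℕ.⊔ L) ℕ.⊔ (M ℕ.⊔ N)
          K≤ = λ {n} (l : Q ℕ.≤ n) → ℕ.m⊔n≤o⇒m≤o K L (ℕ.m⊔n≤o⇒m≤o (K ℕ.⊔ L) (M ℕ.⊔ N) l)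
          L≤ = λ {n} (l : Q ℕ.≤ n) → ℕ.m⊔n≤o⇒n≤o K L (ℕ.m⊔n≤o⇒m≤o (K ℕ.⊔ L) (M ℕ.⊔ N) l)
          M≤ = λ {n} (l : Q ℕ.≤ n) → ℕ.m⊔n≤o⇒m≤o M N (ℕ.m⊔n≤o⇒n≤o (K ℕ.⊔ L) (M ℕ.⊔ N) l)
          N≤ = λ {n} (l : Q ℕ.≤ n) → ℕ.m⊔n≤o⇒n≤o M N (ℕ.m⊔n≤o⇒n≤o (K ℕ.⊔ L) (M ℕ.⊔ N) l)
      in Q , λ m n lm ln → ℚ.≤-trans
           (*-dist (seq x m) (seq y m) (seq x n) (seq y n))
           (split
             (ℚ.≤-trans (*-mono (ℚ.0≤∣p∣ (seq x m)) (ℚ.<⇒≤ 0<δ) (a m (K≤ lm)) (f m n (M≤ lm) (M≤ ln)))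
                        (ℚ.≤-reflexive eδ))
             (ℚ.≤-trans (*-mono (ℚ.0≤∣p∣ (seq y n)) (ℚ.<⇒≤ 0<η) (b n (L≤ ln)) (g m n (N≤ lm) (N≤ ln)))
                        (ℚ.≤-reflexive eη)))

  -_ : ℝ → ℝ
  - x = mkℝ (λ n → ℚ.- seq x n) (neg-cauchy x)

  _+_ _-_ _*_ : ℝ → ℝ → ℝ
  x + y = mkℝ (λ n → seq x n ℚ.+ seq y n) (+-cauchy x y)
  x - y = x + - y
  x * y = mkℝ (λ n → seq x n ℚ.* seq y n) (*-cauchy x y)

  0ℝ 1ℝ : ℝ
  0ℝ = fromℚ 0ℚ
  1ℝ = fromℚ 1ℚ

  eventually : ∀ {x y} → Eventually (λ n → seq x n ≡ seq y n) → x ≈ y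
  eventually {x} {y} (N , e) ε 0<ε = N , λ n le → ℚ.≤-trans
    (ℚ.≤-reflexive (cong ℚ.∣_∣ (trans (cong (ℚ._- seq y n) (e n le)) (ℚ.+-inverseʳ (seq y n)))))
    (ℚ.<⇒≤ 0<ε)

  pointwise : ∀ {x y} → (∀ n → seq x n ≡ seq y n) → x ≈ y
  pointwise {x} {y} e = eventually {x} {y} (0 , λ n _ → e n)

  ≈-isEquivalence : IsEquivalence _≈_
  ≈-isEquivalence = record
    { refl  = λ {x} → pointwise {x} {x} (λ _ → refl)
    ; sym   = λ {x} {y} e ε 0<ε → let N , f = e ε 0<ε in
        N , λ n l → ℚ.≤-trans (ℚ.≤-reflexive (∣-∣-sym (seq y n) (seq x n))) (f n l)
    ; trans = λ {x} {y} {z} e e′ ε 0<ε →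
        let N , f = both (e (½ ℚ.* ε) (½-pos 0<ε)) (e′ (½ ℚ.* ε) (½-pos 0<ε)) in
        N , λ n l → ℚ.≤-trans (triangle (seq x n) (seq y n) (seq z n))
                              (split (proj₁ (f n l)) (proj₂ (f n l)))
    }

  +-cong : ∀ {w x y z} → w ≈ y → x ≈ z → w + x ≈ y + z
  +-cong {w} {x} {y} {z} e e′ ε 0<ε =
    let N , f = both (e (½ ℚ.* ε) (½-pos 0<ε)) (e′ (½ ℚ.* ε) (½-pos 0<ε)) in
    N , λ n l → ℚ.≤-trans (+-dist (seq w n) (seq x n) (seq y n) (seq z n))
                          (split (proj₁ (f n l)) (proj₂ (f n l)))

  -‿cong : ∀ {x y} → x ≈ y → - x ≈ - y
  -‿cong {x} {y} e ε 0<ε = let N , f = e ε 0<ε in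
    N , λ n l → ℚ.≤-trans (ℚ.≤-reflexive (neg-dist (seq x n) (seq y n))) (f n l)

  *-cong : ∀ {w x y z} → w ≈ y → x ≈ z → w * x ≈ y * z
  *-cong {w} {x} {y} {z} e e′ ε 0<ε =
    let A , 0<A , wB = bounded w
        B , 0<B , zB = bounded z
        δ , 0<δ , eδ = dividePos 0<A (½-pos 0<ε)
        η , 0<η , eη = dividePos 0<B (½-pos 0<ε)
        N , f = both (both wB zB) (both (e′ δ 0<δ) (e η 0<η))
    in N , λ n l → let (a , b) , (c , d) = f n l in ℚ.≤-trans
         (*-dist (seq w n) (seq x n) (seq y n) (seq z n))
         (split
           (ℚ.≤-trans (*-mono (ℚ.0≤∣p∣ (seq w n)) (ℚ.<⇒≤ 0<δ) a c) (ℚ.≤-reflexive eδ))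
           (ℚ.≤-trans (*-mono (ℚ.0≤∣p∣ (seq z n)) (ℚ.<⇒≤ 0<η) b d) (ℚ.≤-reflexive eη)))

record ℂ : Set where
  constructor _+i_
  field
    re im : ℝ

open ℂ public

infix 4 _≈_ _⟶_
infixl 6 _+_ _-_
infixl 7 _*_
infix 8 -_
infixr 9 _^_

record _≈_ (z w : ℂ) : Set where
  constructor _∧_
  field
    re≈ : re z Real.≈ re w
    im≈ : im z Real.≈ im w

_+_ _-_ _*_ : ℂ → ℂ → ℂ
z + w = (re z Real.+ re w) +i (im z Real.+ im w)
z - w = (re z Real.- re w) +i (im z Real.- im w)
z * w = (re z Real.* re w Real.- im z Real.* im w) +i (re z Real.* im w Real.+ im z Real.* re w)

-_ : ℂ → ℂ
- z = (Real.- re z) +i (Real.- im z)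

0ℂ 1ℂ : ℂ
0ℂ = Real.0ℝ +i Real.0ℝ
1ℂ = Real.1ℝ +i Real.0ℝ

∣_∣² : ℂ → ℝ
∣ z ∣² = re z Real.* re z Real.+ im z Real.* im z

_^_ : ℂ → ℕ → ℂ
z ^ zero  = 1ℂ
z ^ suc n = z ^ n * z

-- ∣ u n - l ∣ < ε, stated through squares to avoid a square root.
_⟶_ : (ℕ → ℂ) → ℂ → Set
u ⟶ l = ∀ ε → 0ℚ ℚ.< ε → Eventually (λ n → ∣ u n - l ∣² Real.< Real.fromℚ (ε ℚ.* ε))

module _ where
  private
    module R = IsEquivalence Real.≈-isEquivalence
    rr : ∀ z n → ℚ
    rr z n = seq (re z) n
    ii : ∀ z n → ℚ
    ii z n = seq (im z) n

  pointwise : ∀ {z w} → (∀ n → seq (re z) n ≡ seq (re w) n) →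
              (∀ n → seq (im z) n ≡ seq (im w) n) → z ≈ w
  pointwise {z} {w} e f = Real.pointwise {re z} {re w} e ∧ Real.pointwise {im z} {im w} f

  ≈-isEquivalence : IsEquivalence _≈_
  ≈-isEquivalence = record
    { refl  = λ {z} → R.refl {re z} ∧ R.refl {im z}
    ; sym   = λ {z} {w} (e ∧ f) → R.sym {re z} {re w} e ∧ R.sym {im z} {im w} f
    ; trans = λ {u} {v} {w} (e ∧ f) (e′ ∧ f′) →
        R.trans {re u} {re v} {re w} e e′ ∧ R.trans {im u} {im v} {im w} f f′
    }

  +-cong : ∀ {u v w z} → u ≈ w → v ≈ z → u + v ≈ w + z
  +-cong {u} {v} {w} {z} (e ∧ f) (e′ ∧ f′) =
    Real.+-cong {re u} {re v} {re w} {re z} e e′ ∧ Real.+-cong {im u} {im v} {im w} {im z} f f′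

  -‿cong : ∀ {z w} → z ≈ w → - z ≈ - w
  -‿cong {z} {w} (e ∧ f) = Real.-‿cong {re z} {re w} e ∧ Real.-‿cong {im z} {im w} f

  *-cong : ∀ {u v w z} → u ≈ w → v ≈ z → u * v ≈ w * z
  *-cong {u} {v} {w} {z} (e ∧ f) (e′ ∧ f′) =
    Real.+-cong {re u Real.* re v} {Real.- (im u Real.* im v)} {re w Real.* re z} {Real.- (im w Real.* im z)}
      (Real.*-cong {re u} {re v} {re w} {re z} e e′)
      (Real.-‿cong {im u Real.* im v} {im w Real.* im z} (Real.*-cong {im u} {im v} {im w} {im z} f f′)) ∧
    Real.+-cong {re u Real.* im v} {im u Real.* re v} {re w Real.* im z} {im w Real.* re z}
      (Real.*-cong {re u} {im v} {re w} {im z} e f′)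
      (Real.*-cong {im u} {re v} {im w} {re z} f e′)

  isCommutativeRing : IsCommutativeRing _≈_ _+_ _*_ -_ 0ℂ 1ℂ
  isCommutativeRing = record
    { isRing = record
      { +-isAbelianGroup = record
        { isGroup = record
          { isMonoid = record
            { isSemigroup = record
              { isMagma = record
                { isEquivalence = ≈-isEquivalence
                ; ∙-cong = λ {u} {w} {v} {z} → +-cong {u} {v} {w} {z}
                }
              ; assoc = λ u v w → pointwise {(u + v) + w} {u + (v + w)}
                  (λ n → ℚ.+-assoc (rr u n) (rr v n) (rr w n))
                  (λ n → ℚ.+-assoc (ii u n) (ii v n) (ii w n))
              }
            ; identity =
                (λ z → pointwise {0ℂ + z} {z} (λ n → ℚ.+-identityˡ (rr z n)) (λ n → ℚ.+-identityˡ (ii z n))) ,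
                (λ z → pointwise {z + 0ℂ} {z} (λ n → ℚ.+-identityʳ (rr z n)) (λ n → ℚ.+-identityʳ (ii z n)))
            }
          ; inverse =
              (λ z → pointwise { - z + z} {0ℂ} (λ n → ℚ.+-inverseˡ (rr z n)) (λ n → ℚ.+-inverseˡ (ii z n))) ,
              (λ z → pointwise {z + - z} {0ℂ} (λ n → ℚ.+-inverseʳ (rr z n)) (λ n → ℚ.+-inverseʳ (ii z n)))
          ; ⁻¹-cong = λ {z} {w} → -‿cong {z} {w}
          }
        ; comm = λ z w → pointwise {z + w} {w + z}
            (λ n → ℚ.+-comm (rr z n) (rr w n)) (λ n → ℚ.+-comm (ii z n) (ii w n))
        }
      ; *-cong = λ {u} {w} {v} {z} → *-cong {u} {v} {w} {z}
      ; *-assoc = λ u v w → pointwise {(u * v) * w} {u * (v * w)}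
          (λ n → Identities.l2 (rr u n) (ii u n) (rr v n) (ii v n) (rr w n) (ii w n))
          (λ n → Identities.l3 (rr u n) (ii u n) (rr v n) (ii v n) (rr w n) (ii w n))
      ; *-identity =
          (λ z → pointwise {1ℂ * z} {z} (λ n → Identities.l4 (rr z n) (ii z n)) (λ n → Identities.l5 (ii z n) (rr z n))) ,
          (λ z → pointwise {z * 1ℂ} {z} (λ n → Identities.l6 (rr z n) (ii z n)) (λ n → Identities.l7 (rr z n) (ii z n)))
      ; distrib =
          (λ u v w → pointwise {u * (v + w)} {u * v + u * w}
            (λ n → Identities.l8 (rr u n) (ii u n) (rr v n) (ii v n) (rr w n) (ii w n))
            (λ n → Identities.l9 (rr u n) (ii u n) (rr v n) (ii v n) (rr w n) (ii w n))) ,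
          (λ u v w → pointwise {(v + w) * u} {v * u + w * u}
            (λ n → Identities.l10 (rr u n) (ii u n) (rr v n) (ii v n) (rr w n) (ii w n))
            (λ n → Identities.l11 (rr u n) (ii u n) (rr v n) (ii v n) (rr w n) (ii w n)))
      }
    ; *-comm = λ z w → pointwise {z * w} {w * z}
        (λ n → Identities.l12 (rr z n) (ii z n) (rr w n) (ii w n))
        (λ n → Identities.l13 (rr z n) (ii z n) (rr w n) (ii w n))
    }

open import Algebra.Definitions _≈_ using (Invertible)

ℂ-commutativeRing : CommutativeRing 0ℓ 0ℓ
ℂ-commutativeRing = record { isCommutativeRing = isCommutativeRing }

∏< : ℕ → (ℕ → ℂ) → ℂ
∏< zero    f = 1ℂ
∏< (suc n) f = ∏< n f * f n

module Diagonal
  (u : ℕ → ℝ)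
  (uniform : ∀ ε → 0ℚ ℚ.< ε → ∃[ K ] (∀ M N n → K ℕ.≤ M → K ℕ.≤ N → K ℕ.≤ n →
               ℚ.∣ seq (u M) n ℚ.- seq (u N) n ∣ ℚ.≤ ε)) where

  abstract
    diagonal-cauchy : IsCauchy (λ n → seq (u n) n)
    diagonal-cauchy ε 0<ε =
      let ε/2   = ½-pos 0<ε
          ε/4   = ½-pos ε/2
          K , f = uniform _ ε/4
          L , g = cauchy (u K) _ ε/2
          K≤    = λ {n} (l : K ℕ.⊔ L ℕ.≤ n) → ℕ.m⊔n≤o⇒m≤o K L l
          L≤    = λ {n} (l : K ℕ.⊔ L ℕ.≤ n) → ℕ.m⊔n≤o⇒n≤o K L l
      in K ℕ.⊔ L , λ m n lm ln →
        ℚ.≤-trans (triangle (seq (u m) m) (seq (u K) m) (seq (u n) n))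
          (ℚ.≤-trans (ℚ.+-monoʳ-≤ ℚ.∣ seq (u m) m ℚ.- seq (u K) m ∣
                       (triangle (seq (u K) m) (seq (u K) n) (seq (u n) n)))
            (ℚ.≤-trans
              (ℚ.+-mono-≤ (f m K m (K≤ lm) ℕ.≤-refl (K≤ lm))
                (ℚ.+-mono-≤ (g m n (L≤ lm) (L≤ ln)) (f K n n ℕ.≤-refl (K≤ ln) (K≤ ln))))
              (ℚ.≤-reflexive (Identities.quarters ε))))

  diagonal : ℝ
  diagonal = mkℝ (λ n → seq (u n) n) diagonal-cauchy

private
  ‖_‖ : ℂ → ℕ → ℚ
  ‖ z ‖ n = ℚ.∣ seq (re z) n ∣ ℚ.+ ℚ.∣ seq (im z) n ∣

  module Norm where
    open import Data.Rational.Base using (_≤_) renaming (_+_ to _⊕_; _*_ to _⊛_; ∣_∣ to abs)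
    open ℚ.≤-Reasoning

    0≤‖‖ : ∀ z n → 0ℚ ≤ ‖ z ‖ n
    0≤‖‖ z n = +-nonNeg (ℚ.0≤∣p∣ (seq (re z) n)) (ℚ.0≤∣p∣ (seq (im z) n))

    re≤‖‖ : ∀ z n → abs (seq (re z) n) ≤ ‖ z ‖ n
    re≤‖‖ z n = ℚ.≤-trans (ℚ.≤-reflexive (sym (ℚ.+-identityʳ (abs (seq (re z) n)))))
      (ℚ.+-monoʳ-≤ (abs (seq (re z) n)) (ℚ.0≤∣p∣ (seq (im z) n)))

    im≤‖‖ : ∀ z n → abs (seq (im z) n) ≤ ‖ z ‖ n
    im≤‖‖ z n = ℚ.≤-trans (ℚ.≤-reflexive (sym (ℚ.+-identityˡ (abs (seq (im z) n)))))
      (ℚ.+-monoˡ-≤ (abs (seq (im z) n)) (ℚ.0≤∣p∣ (seq (re z) n)))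

    ‖*‖ : ∀ z w n → ‖ z * w ‖ n ≤ ‖ z ‖ n ⊛ ‖ w ‖ n
    ‖*‖ z w n = begin
      ‖ z * w ‖ n
        ≤⟨ ℚ.+-mono-≤ (ℚ.∣p-q∣≤∣p∣+∣q∣ (a ⊛ c) (b ⊛ d)) (ℚ.∣p+q∣≤∣p∣+∣q∣ (a ⊛ d) (b ⊛ c)) ⟩
      (abs (a ⊛ c) ⊕ abs (b ⊛ d)) ⊕ (abs (a ⊛ d) ⊕ abs (b ⊛ c))
        ≡⟨ cong₂ _⊕_ (cong₂ _⊕_ (ℚ.∣p*q∣≡∣p∣*∣q∣ a c) (ℚ.∣p*q∣≡∣p∣*∣q∣ b d))
                     (cong₂ _⊕_ (ℚ.∣p*q∣≡∣p∣*∣q∣ a d) (ℚ.∣p*q∣≡∣p∣*∣q∣ b c)) ⟩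
      (abs a ⊛ abs c ⊕ abs b ⊛ abs d) ⊕ (abs a ⊛ abs d ⊕ abs b ⊛ abs c)
        ≡⟨ Identities.eq₁ (abs a) (abs b) (abs c) (abs d) ⟩
      ‖ z ‖ n ⊛ ‖ w ‖ n ∎
      where
      a = seq (re z) n
      b = seq (im z) n
      c = seq (re w) n
      d = seq (im w) n

    ‖triangle‖ : ∀ u v w n → ‖ u - w ‖ n ≤ ‖ u - v ‖ n ⊕ ‖ v - w ‖ n
    ‖triangle‖ u v w n = ℚ.≤-trans
      (ℚ.+-mono-≤ (triangle (seq (re u) n) (seq (re v) n) (seq (re w) n))
                  (triangle (seq (im u) n) (seq (im v) n) (seq (im w) n)))
      (ℚ.≤-reflexive (Identities.eq₃ (abs (seq (re (u - v)) n)) (abs (seq (re (v - w)) n))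
                                     (abs (seq (im (u - v)) n)) (abs (seq (im (v - w)) n))))

    ‖‖≤ : ∀ z w n → ‖ z ‖ n ≤ ‖ w ‖ n ⊕ ‖ z - w ‖ n
    ‖‖≤ z w n = ℚ.≤-trans
      (ℚ.+-mono-≤ (∣x∣≤∣y∣+∣x-y∣ (seq (re z) n) (seq (re w) n))
                  (∣x∣≤∣y∣+∣x-y∣ (seq (im z) n) (seq (im w) n)))
      (ℚ.≤-reflexive (Identities.eq₃ (abs (seq (re w) n)) (abs (seq (re (z - w)) n))
                                     (abs (seq (im w) n)) (abs (seq (im (z - w)) n))))

    ∣∣²-* : ∀ z w n → seq ∣ z * w ∣² n ≡ seq ∣ z ∣² n ⊛ seq ∣ w ∣² n
    ∣∣²-* z w n = Identities.eq₂ (seq (re z) n) (seq (im z) n) (seq (re w) n) (seq (im w) n)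

    0≤∣∣² : ∀ z n → 0ℚ ≤ seq ∣ z ∣² n
    0≤∣∣² z n = +-nonNeg (0≤x² (seq (re z) n)) (0≤x² (seq (im z) n))

    ‖‖-bound : ∀ z n {σ} → 0ℚ ≤ σ → seq ∣ z ∣² n ≤ σ ⊛ σ → ‖ z ‖ n ≤ σ ⊕ σ
    ‖‖-bound z n {σ} 0≤σ le = ℚ.+-mono-≤
      (≤√ (ℚ.0≤∣p∣ a) 0≤σ (begin
        abs a ⊛ abs a   ≡⟨ ∣x∣²≡x² a ⟩
        a ⊛ a           ≡⟨ ℚ.+-identityʳ (a ⊛ a) ⟨
        a ⊛ a ⊕ 0ℚ      ≤⟨ ℚ.+-monoʳ-≤ (a ⊛ a) (0≤x² b) ⟩
        a ⊛ a ⊕ b ⊛ b   ≤⟨ le ⟩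
        σ ⊛ σ           ∎))
      (≤√ (ℚ.0≤∣p∣ b) 0≤σ (begin
        abs b ⊛ abs b   ≡⟨ ∣x∣²≡x² b ⟩
        b ⊛ b           ≡⟨ ℚ.+-identityˡ (b ⊛ b) ⟨
        0ℚ ⊕ b ⊛ b      ≤⟨ ℚ.+-monoˡ-≤ (b ⊛ b) (0≤x² a) ⟩
        a ⊛ a ⊕ b ⊛ b   ≤⟨ le ⟩
        σ ⊛ σ           ∎))
      where
      a = seq (re z) n
      b = seq (im z) n

-- The hypothesis is ∣ p ∣ < 1, and [ x ]∞ is (x;p)_∞.
module InfinitePochhammer (p : ℂ) (∣p∣<1 : ∣ p ∣² Real.< Real.1ℝ) where

  partialProduct : ℂ → ℕ → ℂ
  partialProduct x N = ∏< N (λ k → 1ℂ - x * p ^ k)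

  private
    open import Data.Rational.Base using (_≤_) renaming (_+_ to _⊕_; _*_ to _⊛_; _-_ to _⊖_; -_ to ⊖_)
    open Norm

    ε₀ = proj₁ ∣p∣<1
    0<ε₀ = proj₁ (proj₂ ∣p∣<1)
    N₀ = proj₁ (proj₂ (proj₂ ∣p∣<1))
    N₀-bound = proj₂ (proj₂ (proj₂ ∣p∣<1))

    s : ℚ
    s = 1ℚ ⊖ ½ ⊛ ε₀

    0<1-s : 0ℚ ℚ.< 1ℚ ⊖ s
    0<1-s = subst (0ℚ ℚ.<_) (Identities.eq₉ ε₀) (½-pos 0<ε₀)

    ∣p∣²≤1-ε₀ : ∀ n → N₀ ℕ.≤ n → seq ∣ p ∣² n ≤ 1ℚ ⊖ ε₀
    ∣p∣²≤1-ε₀ n le = ℚ.≤-trans (ℚ.≤-reflexive (Identities.eq₁₀ (seq ∣ p ∣² n) ε₀))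
      (ℚ.+-monoˡ-≤ (⊖ ε₀) (N₀-bound n le))

    0≤s : 0ℚ ≤ s
    0≤s = ℚ.≤-trans
      (+-nonNeg (ℚ.≤-trans (0≤∣∣² p N₀) (∣p∣²≤1-ε₀ N₀ ℕ.≤-refl)) (ℚ.<⇒≤ (½-pos 0<ε₀)))
      (ℚ.≤-reflexive (Identities.eq₁₁ ε₀))

    ∣p∣²≤s² : ∀ n → N₀ ℕ.≤ n → seq ∣ p ∣² n ≤ s ⊛ s
    ∣p∣²≤s² n le = begin
      seq ∣ p ∣² n                             ≤⟨ ∣p∣²≤1-ε₀ n le ⟩
      1ℚ ⊖ ε₀                                  ≡⟨ ℚ.+-identityʳ (1ℚ ⊖ ε₀) ⟨
      (1ℚ ⊖ ε₀) ⊕ 0ℚ                           ≤⟨ ℚ.+-monoʳ-≤ (1ℚ ⊖ ε₀) (0≤x² (½ ⊛ ε₀)) ⟩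
      (1ℚ ⊖ ε₀) ⊕ (½ ⊛ ε₀) ⊛ (½ ⊛ ε₀)          ≡⟨ Identities.eq₈ ε₀ ⟩
      s ⊛ s                                    ∎
      where open ℚ.≤-Reasoning

    module Uniform (x : ℂ) where
      bre = Real.bounded (re x)
      bim = Real.bounded (im x)

      c d : ℚ
      c = proj₁ bre ⊕ proj₁ bim
      d = c ⊕ c

      0<c : 0ℚ ℚ.< c
      0<c = ℚ.+-mono-< (proj₁ (proj₂ bre)) (proj₁ (proj₂ bim))

      N₁ = both (proj₂ (proj₂ bre)) (proj₂ (proj₂ bim))
      div = dividePos 0<1-s (ℚ.+-mono-< 0<c 0<c)

      e : ℚ
      e = proj₁ div

      n₀ : ℕ
      n₀ = N₀ ℕ.⊔ proj₁ N₁

      0≤d : 0ℚ ≤ d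
      0≤d = ℚ.<⇒≤ (ℚ.+-mono-< 0<c 0<c)

      module M = Majorant.Bound s d e 0≤s 0<1-s 0≤d (ℚ.<⇒≤ (proj₁ (proj₂ div))) (proj₂ (proj₂ div))

      P : ℕ → ℂ
      P = partialProduct x

      module _ (n : ℕ) (n₀≤n : n₀ ℕ.≤ n) where
        open ℚ.≤-Reasoning

        ∣p^k∣² : ∀ k → seq ∣ p ^ k ∣² n ≤ M.pow k ⊛ M.pow k
        ∣p^k∣² zero    = ℚ.≤-refl
        ∣p^k∣² (suc k) = begin
          seq ∣ p ^ k * p ∣² n               ≡⟨ ∣∣²-* (p ^ k) p n ⟩
          seq ∣ p ^ k ∣² n ⊛ seq ∣ p ∣² n
            ≤⟨ *-mono (0≤∣∣² (p ^ k) n) (0≤x² s) (∣p^k∣² k) (∣p∣²≤s² n (ℕ.m⊔n≤o⇒m≤o N₀ (proj₁ N₁) n₀≤n)) ⟩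
          (M.pow k ⊛ M.pow k) ⊛ (s ⊛ s)      ≡⟨ Identities.eq₄ (M.pow k) s ⟩
          M.pow (suc k) ⊛ M.pow (suc k)      ∎

        ‖x‖≤c : ‖ x ‖ n ≤ c
        ‖x‖≤c = let l , r = proj₂ N₁ n (ℕ.m⊔n≤o⇒n≤o N₀ (proj₁ N₁) n₀≤n) in ℚ.+-mono-≤ l r

        ‖xp^k‖ : ∀ k → ‖ x * p ^ k ‖ n ≤ d ⊛ M.pow k
        ‖xp^k‖ k = begin
          ‖ x * p ^ k ‖ n              ≤⟨ ‖*‖ x (p ^ k) n ⟩
          ‖ x ‖ n ⊛ ‖ p ^ k ‖ n
            ≤⟨ *-mono (0≤‖‖ x n) (+-nonNeg (M.0≤pow k) (M.0≤pow k)) ‖x‖≤c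
                 (‖‖-bound (p ^ k) n (M.0≤pow k) (∣p^k∣² k)) ⟩
          c ⊛ (M.pow k ⊕ M.pow k)      ≡⟨ Identities.eq₅ c (M.pow k) ⟩
          d ⊛ M.pow k                  ∎

        ‖step‖ : ∀ k → ‖ P (suc k) - P k ‖ n ≤ ‖ P k ‖ n ⊛ (d ⊛ M.pow k)
        ‖step‖ k = begin
          ‖ P (suc k) - P k ‖ n
            ≡⟨ cong₂ _⊕_ (trans (cong ℚ.∣_∣ (Identities.eq₁₂ a b u v)) (ℚ.∣-p∣≡∣p∣ (a ⊛ u ⊖ b ⊛ v)))
                         (trans (cong ℚ.∣_∣ (Identities.eq₁₃ a b u v)) (ℚ.∣-p∣≡∣p∣ (a ⊛ v ⊕ b ⊛ u))) ⟩
          ‖ P k * (x * p ^ k) ‖ n        ≤⟨ ‖*‖ (P k) (x * p ^ k) n ⟩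
          ‖ P k ‖ n ⊛ ‖ x * p ^ k ‖ n    ≤⟨ *-monoʳ (0≤‖‖ (P k) n) (‖xp^k‖ k) ⟩
          ‖ P k ‖ n ⊛ (d ⊛ M.pow k)      ∎
          where
          a = seq (re (P k)) n
          b = seq (im (P k)) n
          u = seq (re (x * p ^ k)) n
          v = seq (im (x * p ^ k)) n

        0≤dP : ∀ k → 0ℚ ≤ d ⊛ M.pow k
        0≤dP k = *-nonNeg 0≤d (M.0≤pow k)

        ‖P‖ : ∀ k → ‖ P k ‖ n ≤ M.bound k
        ‖P‖ zero    = ℚ.≤-refl
        ‖P‖ (suc k) = begin
          ‖ P (suc k) ‖ n                           ≤⟨ ‖‖≤ (P (suc k)) (P k) n ⟩
          ‖ P k ‖ n ⊕ ‖ P (suc k) - P k ‖ n         ≤⟨ ℚ.+-monoʳ-≤ (‖ P k ‖ n) (‖step‖ k) ⟩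
          ‖ P k ‖ n ⊕ ‖ P k ‖ n ⊛ (d ⊛ M.pow k)     ≡⟨ Identities.eq₁₄ (‖ P k ‖ n) (d ⊛ M.pow k) ⟩
          ‖ P k ‖ n ⊛ (1ℚ ⊕ d ⊛ M.pow k)            ≤⟨ *-monoˡ (+-nonNeg 0≤1 (0≤dP k)) (‖P‖ k) ⟩
          M.bound (suc k)                           ∎

        ‖P-P‖ : ∀ N i → M.bound N ⊕ ‖ P (i ℕ.+ N) - P N ‖ n ≤ M.bound (i ℕ.+ N)
        ‖P-P‖ N zero    = ℚ.≤-reflexive (trans
          (cong (M.bound N ⊕_) (cong₂ (λ y z → ℚ.∣ y ∣ ⊕ ℚ.∣ z ∣)
            (ℚ.+-inverseʳ (seq (re (P N)) n)) (ℚ.+-inverseʳ (seq (im (P N)) n))))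
          (ℚ.+-identityʳ (M.bound N)))
        ‖P-P‖ N (suc i) = begin
          M.bound N ⊕ ‖ P (suc K) - P N ‖ n
            ≤⟨ ℚ.+-monoʳ-≤ (M.bound N) (‖triangle‖ (P (suc K)) (P K) (P N) n) ⟩
          M.bound N ⊕ (‖ P (suc K) - P K ‖ n ⊕ ‖ P K - P N ‖ n)
            ≡⟨ Identities.eq₁₆ (‖ P (suc K) - P K ‖ n) (M.bound N) (‖ P K - P N ‖ n) ⟨
          (‖ P (suc K) - P K ‖ n ⊕ M.bound N) ⊕ ‖ P K - P N ‖ n
            ≡⟨ ℚ.+-assoc (‖ P (suc K) - P K ‖ n) (M.bound N) (‖ P K - P N ‖ n) ⟩
          ‖ P (suc K) - P K ‖ n ⊕ (M.bound N ⊕ ‖ P K - P N ‖ n)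
            ≤⟨ ℚ.+-mono-≤ (ℚ.≤-trans (‖step‖ K) (*-monoˡ (0≤dP K) (‖P‖ K))) (‖P-P‖ N i) ⟩
          M.bound K ⊛ (d ⊛ M.pow K) ⊕ M.bound K
            ≡⟨ ℚ.+-comm (M.bound K ⊛ (d ⊛ M.pow K)) (M.bound K) ⟩
          M.bound K ⊕ M.bound K ⊛ (d ⊛ M.pow K)
            ≡⟨ Identities.eq₁₄ (M.bound K) (d ⊛ M.pow K) ⟩
          M.bound (suc K) ∎
          where K = i ℕ.+ N

      uniform : ∀ ε → 0ℚ ℚ.< ε → ∃[ K ] (∀ M N n → K ℕ.≤ M → K ℕ.≤ N → K ℕ.≤ n →
        ‖ P M - P N ‖ n ≤ ε)
      uniform ε 0<ε = let K , f = M.bound-cauchy ε 0<ε in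
        K ℕ.⊔ n₀ , λ M N n lM lN ln → go K f M N n
          (ℕ.m⊔n≤o⇒m≤o K n₀ lM) (ℕ.m⊔n≤o⇒m≤o K n₀ lN) (ℕ.m⊔n≤o⇒n≤o K n₀ ln) (ℕ.≤-total N M)
        where
        open ℚ.≤-Reasoning
        module _ (K : ℕ) (f : ∀ N → K ℕ.≤ N → ∀ i → M.bound (i ℕ.+ N) ≤ M.bound N ⊕ ε) where
          above : ∀ i N n → K ℕ.≤ N → n₀ ℕ.≤ n → ‖ P (i ℕ.+ N) - P N ‖ n ≤ ε
          above i N n lN ln = begin
            ‖ P (i ℕ.+ N) - P N ‖ n                               ≡⟨ Identities.eq₁₅ (M.bound N) (‖ P (i ℕ.+ N) - P N ‖ n) ⟨
            (M.bound N ⊕ ‖ P (i ℕ.+ N) - P N ‖ n) ⊖ M.bound N     ≤⟨ ℚ.+-monoˡ-≤ (⊖ M.bound N) (ℚ.≤-trans (‖P-P‖ n ln N i) (f N lN i)) ⟩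
            (M.bound N ⊕ ε) ⊖ M.bound N                           ≡⟨ Identities.eq₁₅ (M.bound N) ε ⟩
            ε                                                     ∎
          go : ∀ M N n → K ℕ.≤ M → K ℕ.≤ N → n₀ ℕ.≤ n → N ℕ.≤ M ⊎ M ℕ.≤ N → ‖ P M - P N ‖ n ≤ ε
          go M N n lM lN ln (inj₁ N≤M) =
            subst (λ M → ‖ P M - P N ‖ n ≤ ε) (ℕ.m∸n+n≡m N≤M) (above (M ℕ.∸ N) N n lN ln)
          go M N n lM lN ln (inj₂ M≤N) = ℚ.≤-trans
            (ℚ.≤-reflexive (cong₂ _⊕_ (∣-∣-sym (seq (re (P M)) n) (seq (re (P N)) n))
                                      (∣-∣-sym (seq (im (P M)) n) (seq (im (P N)) n))))
            (subst (λ N → ‖ P N - P M ‖ n ≤ ε) (ℕ.m∸n+n≡m M≤N) (above (N ℕ.∸ M) M n lM ln))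

      uniform-re : ∀ ε → 0ℚ ℚ.< ε → ∃[ K ] (∀ M N n → K ℕ.≤ M → K ℕ.≤ N → K ℕ.≤ n →
        ℚ.∣ seq (re (P M)) n ⊖ seq (re (P N)) n ∣ ≤ ε)
      uniform-re ε 0<ε = let K , f = uniform ε 0<ε in K , λ M N n a b c →
        ℚ.≤-trans (re≤‖‖ (P M - P N) n) (f M N n a b c)

      uniform-im : ∀ ε → 0ℚ ℚ.< ε → ∃[ K ] (∀ M N n → K ℕ.≤ M → K ℕ.≤ N → K ℕ.≤ n →
        ℚ.∣ seq (im (P M)) n ⊖ seq (im (P N)) n ∣ ≤ ε)
      uniform-im ε 0<ε = let K , f = uniform ε 0<ε in K , λ M N n a b c →
        ℚ.≤-trans (im≤‖‖ (P M - P N) n) (f M N n a b c)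

      limit : ℂ
      limit = Diagonal.diagonal (λ N → re (P N)) uniform-re
           +i Diagonal.diagonal (λ N → im (P N)) uniform-im

      converges : P ⟶ limit
      converges ε 0<ε =
        let δ     = ½ ⊛ ε
            0<δ   = ½-pos 0<ε
            K , f = uniform-re δ 0<δ
            L , g = uniform-im δ 0<δ
            K≤    = λ {n} (l : K ℕ.⊔ L ℕ.≤ n) → ℕ.m⊔n≤o⇒m≤o K L l
            L≤    = λ {n} (l : K ℕ.⊔ L ℕ.≤ n) → ℕ.m⊔n≤o⇒n≤o K L l
            square : ∀ q → ℚ.∣ q ∣ ≤ δ → q ⊛ q ≤ δ ⊛ δ
            square q le = ℚ.≤-trans (ℚ.≤-reflexive (sym (∣x∣²≡x² q)))
                            (*-mono (ℚ.0≤∣p∣ q) (ℚ.<⇒≤ 0<δ) le le)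
        in K ℕ.⊔ L , λ N lN → ½ ⊛ (ε ⊛ ε) , ½-pos (*-pos 0<ε 0<ε) , K ℕ.⊔ L , λ n ln →
          ℚ.≤-trans
            (ℚ.+-monoˡ-≤ (½ ⊛ (ε ⊛ ε))
              (ℚ.+-mono-≤
                (square (seq (re (P N - limit)) n) (f N n n (K≤ lN) (K≤ ln) (K≤ ln)))
                (square (seq (im (P N - limit)) n) (g N n n (L≤ lN) (L≤ ln) (L≤ ln)))))
            (ℚ.≤-reflexive (Identities.eq₇ ε))

  [_]∞ : ℂ → ℂ
  [ x ]∞ = Uniform.limit x

  partialProduct⟶ : ∀ x → partialProduct x ⟶ [ x ]∞
  partialProduct⟶ x = Uniform.converges x

module Inverse (z : ℂ) (z≠0 : Real.0ℝ Real.< ∣ z ∣²) where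
  private
    open import Data.Rational.Base using (_≤_; _⊔_) renaming (_+_ to _⊕_; _*_ to _⊛_; _-_ to _⊖_; -_ to ⊖_)

    ε₀ = proj₁ z≠0
    0<ε₀ = proj₁ (proj₂ z≠0)
    N₀ = proj₁ (proj₂ (proj₂ z≠0))

    d : ℕ → ℚ
    d n = seq ∣ z ∣² n

    ε₀≤d : ∀ n → N₀ ℕ.≤ n → ε₀ ≤ d n
    ε₀≤d n le = ℚ.≤-trans (ℚ.≤-reflexive (sym (ℚ.+-identityˡ ε₀))) (proj₂ (proj₂ (proj₂ z≠0)) n le)

    -- d n ⊔ ε₀ is positive for every n and eventually equal to d n.
    y : ℕ → ℚ
    y n = d n ⊔ ε₀

    0<y : ∀ n → 0ℚ ℚ.< y n
    0<y n = ℚ.<-≤-trans 0<ε₀ (ℚ.p≤q⊔p (d n) ε₀)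

    y≡d : ∀ n → N₀ ℕ.≤ n → y n ≡ d n
    y≡d n le = ℚ.p≥q⇒p⊔q≡p (ε₀≤d n le)

    1/y : ∀ n → ∃[ r ] 0ℚ ℚ.< r × y n ⊛ r ≡ 1ℚ
    1/y n = dividePos (0<y n) (ℚ.positive⁻¹ 1ℚ)

    r : ℕ → ℚ
    r n = proj₁ (1/y n)

    0≤r : ∀ n → 0ℚ ≤ r n
    0≤r n = ℚ.<⇒≤ (proj₁ (proj₂ (1/y n)))

    yr≡1 : ∀ n → y n ⊛ r n ≡ 1ℚ
    yr≡1 n = proj₂ (proj₂ (1/y n))

    1/ε₀ = dividePos 0<ε₀ (ℚ.positive⁻¹ 1ℚ)
    B = proj₁ 1/ε₀
    0≤B = ℚ.<⇒≤ (proj₁ (proj₂ 1/ε₀))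

    r≤B : ∀ n → r n ≤ B
    r≤B n = begin
      r n                 ≡⟨ ℚ.*-identityˡ (r n) ⟨
      1ℚ ⊛ r n            ≡⟨ cong (_⊛ r n) (proj₂ (proj₂ 1/ε₀)) ⟨
      (ε₀ ⊛ B) ⊛ r n      ≡⟨ Identities.eq₁₇ ε₀ B (r n) ⟩
      B ⊛ (ε₀ ⊛ r n)      ≤⟨ *-monoʳ 0≤B (*-monoˡ (0≤r n) (ℚ.p≤q⊔p (d n) ε₀)) ⟩
      B ⊛ (y n ⊛ r n)     ≡⟨ cong (B ⊛_) (yr≡1 n) ⟩
      B ⊛ 1ℚ              ≡⟨ ℚ.*-identityʳ B ⟩
      B                   ∎
      where open ℚ.≤-Reasoning

    difference : ∀ m n → r m ⊖ r n ≡ (r m ⊛ r n) ⊛ (y n ⊖ y m)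
    difference m n = begin
      r m ⊖ r n                                         ≡⟨ cong₂ _⊖_ (ℚ.*-identityʳ (r m)) (ℚ.*-identityʳ (r n)) ⟨
      r m ⊛ 1ℚ ⊖ r n ⊛ 1ℚ                               ≡⟨ cong₂ (λ a b → r m ⊛ a ⊖ r n ⊛ b) (yr≡1 n) (yr≡1 m) ⟨
      r m ⊛ (y n ⊛ r n) ⊖ r n ⊛ (y m ⊛ r m)             ≡⟨ Identities.eq₁₈ (r m) (r n) (y n) (y m) ⟩
      (r m ⊛ r n) ⊛ (y n ⊖ y m)                         ∎
      where open ≡-Reasoning

    abstract
      r-cauchy : IsCauchy r
      r-cauchy ε 0<ε =
        let 0<B = proj₁ (proj₂ 1/ε₀)
            δ , 0<δ , e = dividePos (*-pos 0<B 0<B) 0<ε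
            N , f = cauchy ∣ z ∣² δ 0<δ
        in N₀ ℕ.⊔ N , λ m n lm ln →
          let N₀≤m = ℕ.m⊔n≤o⇒m≤o N₀ N lm
              N₀≤n = ℕ.m⊔n≤o⇒m≤o N₀ N ln
              0≤rr = *-nonNeg (0≤r m) (0≤r n)
          in begin
            ℚ.∣ r m ⊖ r n ∣                                ≡⟨ cong ℚ.∣_∣ (difference m n) ⟩
            ℚ.∣ (r m ⊛ r n) ⊛ (y n ⊖ y m) ∣                ≡⟨ ℚ.∣p*q∣≡∣p∣*∣q∣ (r m ⊛ r n) (y n ⊖ y m) ⟩
            ℚ.∣ r m ⊛ r n ∣ ⊛ ℚ.∣ y n ⊖ y m ∣              ≡⟨ cong₂ _⊛_ (ℚ.0≤p⇒∣p∣≡p 0≤rr) (cong₂ (λ a b → ℚ.∣ a ⊖ b ∣) (y≡d n N₀≤n) (y≡d m N₀≤m)) ⟩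
            (r m ⊛ r n) ⊛ ℚ.∣ d n ⊖ d m ∣                  ≤⟨ *-mono 0≤rr (ℚ.<⇒≤ 0<δ) (*-mono (0≤r m) 0≤B (r≤B m) (r≤B n))
                                                                (f n m (ℕ.m⊔n≤o⇒n≤o N₀ N ln) (ℕ.m⊔n≤o⇒n≤o N₀ N lm)) ⟩
            (B ⊛ B) ⊛ δ                                    ≡⟨ e ⟩
            ε                                              ∎
        where open ℚ.≤-Reasoning

    ∣z∣⁻² : ℝ
    ∣z∣⁻² = mkℝ r r-cauchy

    dr≡1 : ∀ n → N₀ ℕ.≤ n → d n ⊛ r n ≡ 1ℚ
    dr≡1 n le = trans (cong (_⊛ r n) (sym (y≡d n le))) (yr≡1 n)

  inverse : ℂ
  inverse = (re z Real.* ∣z∣⁻²) +i (Real.- (im z Real.* ∣z∣⁻²))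

  inverseʳ : z * inverse ≈ 1ℂ
  inverseʳ =
    Real.eventually {re (z * inverse)} {Real.1ℝ} (N₀ , λ n le →
      trans (Identities.eq₁₉ (seq (re z) n) (seq (im z) n) (r n)) (dr≡1 n le)) ∧
    Real.eventually {im (z * inverse)} {Real.0ℝ} (0 , λ n _ →
      Identities.eq₂₀ (seq (re z) n) (seq (im z) n) (r n))

nonzero⇒invertible : ∀ {z} → Real.0ℝ Real.< ∣ z ∣² → Invertible 1ℂ _*_ z
nonzero⇒invertible {z} z≠0 = inverse ,
  ≈.trans {inverse * z} {z * inverse} {1ℂ} (IsCommutativeRing.*-comm isCommutativeRing inverse z) inverseʳ ,
  inverseʳ
  where
  open Inverse z z≠0
  module ≈ = IsEquivalence ≈-isEquivalence

record ℂˣ : Set where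
  constructor unit
  field
    value      : ℂ
    invertible : Invertible 1ℂ _*_ value

open ℂˣ public

infixl 7 _·_
infix  9 _⁻¹
infixr 9 _^ℕ_ _^ℤ_

1ˣ : ℂˣ
1ˣ = unit 1ℂ (1ℂ , *-identityˡ 1ℂ , *-identityˡ 1ℂ)
  where open CommutativeRing ℂ-commutativeRing

_·_ : ℂˣ → ℂˣ → ℂˣ
unit z (z′ , z′z≈1 , zz′≈1) · unit w (w′ , w′w≈1 , ww′≈1) = unit (z * w)
  ( z′ * w′
  , ≈-trans (interchange z′ w′ z w) (≈-trans (*-cong′ z′z≈1 w′w≈1) (*-identityˡ 1ℂ))
  , ≈-trans (interchange z w z′ w′) (≈-trans (*-cong′ zz′≈1 ww′≈1) (*-identityˡ 1ℂ)))
  where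
  open CommutativeRing ℂ-commutativeRing using (*-identityˡ; *-commutativeSemigroup)
    renaming (trans to ≈-trans; *-cong to *-cong′)
  open CommutativeSemigroupProperties *-commutativeSemigroup using (interchange)

_⁻¹ : ℂˣ → ℂˣ
(unit z (z′ , z′z≈1 , zz′≈1)) ⁻¹ = unit z′ (z , zz′≈1 , z′z≈1)

_^ℕ_ : ℂˣ → ℕ → ℂˣ
x ^ℕ zero  = 1ˣ
x ^ℕ suc n = x ^ℕ n · x

_^ℤ_ : ℂˣ → ℤ → ℂˣ
x ^ℤ (+ n)    = x ^ℕ n
x ^ℤ -[1+ n ] = (x ^ℕ suc n) ⁻¹

-- A quotient is defined only when its denominator is invertible, so an
-- expression denotes a complex number only on a proof that none of the
-- denominators in it vanish.
record Partial : Set₁ where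
  constructor partially
  field
    Defined : Set
    val     : Defined → ℂ

open Partial public

infixl 6 _⊕_
infixl 7 _⊗_ _⊘_

pure : ℂ → Partial
pure z = partially ⊤ (λ _ → z)

_⊕_ _⊗_ _⊘_ : Partial → Partial → Partial
x ⊕ y = partially (Defined x × Defined y) (λ (d , e) → val x d + val y e)
x ⊗ y = partially (Defined x × Defined y) (λ (d , e) → val x d * val y e)
x ⊘ y = partially
  (Σ[ (d , e) ∈ Defined x × Defined y ] Invertible 1ℂ _*_ (val y e))
  (λ ((d , _) , (y⁻¹ , _)) → val x d * y⁻¹)

∏[_⋯_] : ℕ → ℕ → (ℕ → Partial) → Partial
∏[ lo ⋯ hi ] f = List.foldr (λ k x → f (lo ℕ.+ k) ⊗ x) (pure 1ℂ) (List.upTo (suc hi ℕ.∸ lo))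

∑ : {A : Set} → List A → (A → Partial) → Partial
∑ xs f = List.foldr (λ x s → f x ⊕ s) (pure 0ℂ) xs

-- The k-th part, counted from 1; parts beyond the last one are 0.
part : ∀ {n} → Vec ℕ n → ℕ → ℕ
part []       _             = 0
part (x ∷ xs) zero          = 0
part (x ∷ xs) (suc zero)    = x
part (x ∷ xs) (suc (suc k)) = part xs (suc k)

record Partition (n : ℕ) : Set where
  field
    parts      : Vec ℕ n
    decreasing : Linked ℕ._≥_ parts

open Partition public

infix 4 _⊆_

_⊆_ : ∀ {n} → Partition n → Partition n → Set
lam ⊆ π = ∀ i → Vec.lookup (parts lam) i ℕ.≤ Vec.lookup (parts π) i

-- λ₁ ≥ μ₁ ≥ λ₂ ≥ μ₂ ≥ … ≥ λₙ ≥ μₙ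
Interlacing : ∀ {n} → Vec ℕ n → Vec ℕ n → Set
Interlacing {n} lam μ = (i : Fin n) → let k = suc (Fin.toℕ i) in
  part μ k ℕ.≤ part lam k × part lam (suc k) ℕ.≤ part μ k

interlacing? : ∀ {n} (lam μ : Vec ℕ n) → Dec (Interlacing lam μ)
interlacing? lam μ = all? (λ i → let k = suc (Fin.toℕ i) in
  (part μ k ℕ.≤? part lam k) ×-dec (part lam (suc k) ℕ.≤? part μ k))

below : ∀ {n} → Vec ℕ n → List (Vec ℕ n)
below []       = [] ∷ []
below (x ∷ xs) = List.cartesianProductWith _∷_ (List.upTo (suc x)) (below xs)

interlacedBy : ∀ {n} → Vec ℕ n → List (Vec ℕ n)
interlacedBy lam = List.filter (interlacing? lam) (below lam)

module Elliptic (p : ℂ) (∣p∣<1 : ∣ p ∣² Real.< Real.1ℝ) (q t : ℂˣ) where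
  open InfinitePochhammer p ∣p∣<1

  E : ℂˣ → ℂ
  E x = [ value x ]∞ * [ p * value (x ⁻¹) ]∞

  pochℕ : ℂˣ → ℕ → ℂ
  pochℕ a m = ∏< m (λ k → E (a · q ^ℤ (+ k)))

  -- Under interlacing every integer subscript below is nonnegative.
  poch : ℂˣ → ℤ → Partial
  poch a (+ m)    = pure (pochℕ a m)
  poch a -[1+ m ] = pure 1ℂ ⊘ pure (pochℕ (a · q ^ℤ -[1+ m ]) (suc m))

  -- The indices i of ∏< run from 0, so that the i-th factor here has t^{-i}.
  pochλ : ∀ {n} → ℂˣ → Vec ℕ n → ℂ
  pochλ {n} a lam = ∏< n (λ i → pochℕ (a · t ^ℤ (ℤ.- (+ i))) (part lam (suc i)))

  -- (a)_λ/(a)_μ for μ ⊆ λ with the common factors cancelled, that is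
  -- ∏_i ∏_{μ_i ≤ k < λ_i} E(a t^{1-i} q^k).  For a = x⁻¹ the uncancelled
  -- quotient reads 0/0 at x = q^m as soon as μ_1 > m; this is its value
  -- there by continuation in x.
  pochRatio : ∀ {n} → ℂˣ → Vec ℕ n → Vec ℕ n → ℂ
  pochRatio {n} a lam μ = ∏< n (λ i → let μᵢ = part μ (suc i) in
    ∏< (part lam (suc i) ℕ.∸ μᵢ) (λ k → E (a · t ^ℤ (ℤ.- (+ i)) · q ^ℤ (+ (μᵢ ℕ.+ k)))))

  module _ {n : ℕ} (lam μ : Vec ℕ n) (b : ℂˣ) where
    private
      lamᵢ μᵢ : ℕ → ℤ
      lamᵢ i = + part lam i
      μᵢ   i = + part μ i

    H : Partial
    H = (∏[ 1 ⋯ n ] λ i → ∏[ suc i ⋯ n ] λ j →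
          let m = μᵢ (j ℕ.∸ 1) ℤ.- lamᵢ j
              d = + j ℤ.- + i
              σ = + j ℤ.+ + i
          in
            ((poch (q ^ℤ (μᵢ i ℤ.- μᵢ (j ℕ.∸ 1)) · t ^ℤ d) m
              ⊗ poch (q ^ℤ (lamᵢ i ℤ.+ lamᵢ j) · t ^ℤ (+ 3 ℤ.- σ) · b) m)
             ⊘ (poch (q ^ℤ (μᵢ i ℤ.- μᵢ (j ℕ.∸ 1) ℤ.+ + 1) · t ^ℤ (d ℤ.- + 1)) m
              ⊗ poch (q ^ℤ (lamᵢ i ℤ.+ lamᵢ j ℤ.+ + 1) · t ^ℤ (+ 2 ℤ.- σ) · b) m))
            ⊗ (poch (q ^ℤ (lamᵢ i ℤ.- μᵢ (j ℕ.∸ 1) ℤ.+ + 1) · t ^ℤ (d ℤ.- + 1)) m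
             ⊘ poch (q ^ℤ (lamᵢ i ℤ.- μᵢ (j ℕ.∸ 1)) · t ^ℤ d) m))
      ⊗ (∏[ 1 ⋯ n ] λ i → ∏[ suc (suc i) ⋯ suc n ] λ j →
          let m = μᵢ (j ℕ.∸ 1) ℤ.- lamᵢ j
              σ = + j ℤ.+ + i
          in
            poch (q ^ℤ (μᵢ i ℤ.+ lamᵢ j ℤ.+ + 1) · t ^ℤ (+ 1 ℤ.- σ) · b) m
            ⊘ poch (q ^ℤ (μᵢ i ℤ.+ lamᵢ j) · t ^ℤ (+ 2 ℤ.- σ) · b) m)

    W₁-interlaced : (x a : ℂˣ) → Partial
    W₁-interlaced x a =
      H
      ⊗ (pure (pochRatio (x ⁻¹) lam μ) ⊗ pure (pochRatio (a · x) lam μ))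
      ⊗ ((pure (pochλ (q · b · x · t ⁻¹) μ) ⊗ pure (pochλ (q · b · (a · x · t) ⁻¹) μ))
         ⊘ (pure (pochλ (q · b · x) lam) ⊗ pure (pochλ (q · b · (a · x) ⁻¹) lam)))
      ⊗ (∏[ 1 ⋯ n ] λ i →
          let β = b · t ^ℤ (+ 1 ℤ.- + 2 ℤ.* + i)
              m = μᵢ i ℤ.+ lamᵢ (suc i)
          in
            (pure (E (β · q ^ℤ (+ 2 ℤ.* μᵢ i))) ⊘ pure (E β))
            ⊗ (poch β m ⊘ poch (b · q · t ^ℤ (ℤ.- (+ 2 ℤ.* + i))) m)
            ⊗ pure (value (t ^ℤ (+ i ℤ.* (μᵢ i ℤ.- lamᵢ (suc i))))))

    W₁ : (x a : ℂˣ) → Partial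
    W₁ x a = if does (interlacing? lam μ) then W₁-interlaced x a else pure 0ℂ

  Wskew : ∀ {n ℓ} → Vec ℕ n → Vec ℕ n → Vec ℂˣ (suc ℓ) → (a b : ℂˣ) → Partial
  Wskew         lam μ (x ∷ [])     a b = W₁ lam μ b x a
  Wskew {ℓ = ℓ} lam μ (y ∷ z ∷ zs) a b = ∑ (interlacedBy lam) λ ν →
    W₁ lam ν (b · t ^ℤ (+ ℓ)) (y · t ^ℤ (ℤ.- (+ ℓ))) (a · t ^ℤ (+ 2 ℤ.* + ℓ))
    ⊗ Wskew ν μ (z ∷ zs) a b

  W : ∀ {n ℓ} → Partition n → Vec ℂˣ (suc ℓ) → (a b : ℂˣ) → Partial
  W {n} lam xs a b = Wskew (parts lam) (Vec.replicate n 0) xs a b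

  q^_t^δ : ∀ {n} → Partition n → Vec ℂˣ n
  q^_t^δ {n} π = Vec.tabulate λ i →
    q ^ℤ (+ Vec.lookup (parts π) i) · t ^ℤ (+ (n ℕ.∸ suc (Fin.toℕ i)))

  module _ where
    private
      module ℂ-Ring = CommutativeRing ℂ-commutativeRing
      open CommutativeSemigroupProperties ℂ-Ring.*-commutativeSemigroup using (interchange)

    ∏<-+ : ∀ m d f → ∏< m f * ∏< d (λ k → f (m ℕ.+ k)) ≈ ∏< (m ℕ.+ d) f
    ∏<-+ m zero    f rewrite ℕ.+-identityʳ m = ℂ-Ring.*-identityʳ (∏< m f)
    ∏<-+ m (suc d) f rewrite ℕ.+-suc m d = ℂ-Ring.trans
      (ℂ-Ring.sym (ℂ-Ring.*-assoc (∏< m f) (∏< d (λ k → f (m ℕ.+ k))) (f (m ℕ.+ d))))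
      (ℂ-Ring.*-congʳ {f (m ℕ.+ d)} (∏<-+ m d f))

    ∏<-* : ∀ n f g h → (∀ i → f i * g i ≈ h i) → ∏< n f * ∏< n g ≈ ∏< n h
    ∏<-* zero    f g h e = ℂ-Ring.*-identityˡ 1ℂ
    ∏<-* (suc n) f g h e = ℂ-Ring.trans
      (interchange (∏< n f) (f n) (∏< n g) (g n))
      (ℂ-Ring.*-cong (∏<-* n f g h e) (e n))

    -- pochRatio is the quotient (a)_λ/(a)_μ wherever (a)_μ is invertible.
    pochλ-pochRatio : ∀ {n} a (lam μ : Vec ℕ n) → (∀ k → part μ k ℕ.≤ part lam k) →
                      pochλ a μ * pochRatio a lam μ ≈ pochλ a lam
    pochλ-pochRatio {n} a lam μ μ≤lam = ∏<-* n _ _ _ λ i →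
      let c = a · t ^ℤ (ℤ.- (+ i)) in
      subst (λ m → pochℕ c (part μ (suc i))
                   * ∏< (part lam (suc i) ℕ.∸ part μ (suc i)) (λ k → E (c · q ^ℤ (+ (part μ (suc i) ℕ.+ k))))
                   ≈ pochℕ c m)
            (ℕ.m+[n∸m]≡n (μ≤lam (suc i)))
            (∏<-+ (part μ (suc i)) (part lam (suc i) ℕ.∸ part μ (suc i)) (λ k → E (c · q ^ℤ (+ k))))

-- The t-powers of q^π t^δ cancel those in the branching rule, so removing the
-- k-th variable contributes the factors E(q^{m-π_k}), ν_1 ≤ m < λ_1, of
-- (x⁻¹)_λ/(x⁻¹)_ν at x = q^{π_k}.  As E(1) = 0, a chain
-- λ = ν⁰ ⊇ ν¹ ⊇ ⋯ ⊇ νⁿ = 0 contributes zero as soon as ν^k_1 ≤ π_k < ν^{k-1}_1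
-- for some k.  If λ_i > π_i, interlacing gives ν^{i-1}_1 ≥ λ_i > π_i, so in a
-- nonzero term ν^k_1 > π_k for all k ≥ i, contradicting νⁿ = 0.
module Submission where

open import Defs
open import Algebra.Bundles using (CommutativeRing)
open import Data.Bool.Base using (if_then_else_)
open import Data.Fin.Base using (Fin; zero; suc; fromℕ<; toℕ)
open import Data.Fin.Properties using (toℕ-fromℕ<; ¬∀⟶∃¬)
import Data.Integer.Base as ℤ
open import Data.List.Base as List using (List; []; _∷_)
open import Data.Nat.Base using (ℕ; suc; zero; s<s; z<s)
import Data.Nat.Base as ℕ
import Data.Nat.Properties as ℕ
open import Data.Product.Base using (∃-syntax; _×_; _,_; proj₁; proj₂)
open import Data.Rational.Base as ℚ using (0ℚ; ½)
import Data.Rational.Properties as ℚ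
open import Data.Sum.Base as Sum using (_⊎_; inj₁; inj₂)
open import Data.Vec.Base as Vec using (Vec; []; _∷_)
open import Data.Vec.Relation.Unary.Linked as Linked using (Linked; _∷_)
open import Relation.Binary.PropositionalEquality using (_≡_; refl; sym; cong; subst)
open import Relation.Nullary.Decidable using (Dec; yes; no; does)
open import Relation.Nullary.Negation using (¬_; contradiction)

open ℚ-Estimates
private module C = CommutativeRing ℂ-commutativeRing

-- Uniqueness of limits of complex sequences.

≈-byTriangle : ∀ {x y} → (∀ ε → 0ℚ ℚ.< ε → Eventually λ n →
                 ℚ.∣ seq x n ℚ.- seq y n ∣ ℚ.≤ ½ ℚ.* ε ℚ.+ ½ ℚ.* ε) → x Real.≈ y
≈-byTriangle f ε 0<ε = let N , g = f ε 0<ε in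
  N , λ n le → ℚ.≤-trans (g n le) (ℚ.≤-reflexive (halves ε))

-- Extracts one coordinate from the squared distance in `_⟶_`; `δ` is the margin witnessing the
-- strict inequality there.
∣x∣≤√ : ∀ {x y ε δ} → 0ℚ ℚ.< ε → 0ℚ ℚ.< δ →
        (x ℚ.* x ℚ.+ y ℚ.* y) ℚ.+ δ ℚ.≤ ε ℚ.* ε → ℚ.∣ x ∣ ℚ.≤ ε
∣x∣≤√ {x} {y} {ε} {δ} 0<ε 0<δ le = ≤√ (ℚ.0≤∣p∣ x) (ℚ.<⇒≤ 0<ε) (begin
  ℚ.∣ x ∣ ℚ.* ℚ.∣ x ∣              ≡⟨ ∣x∣²≡x² x ⟩
  x ℚ.* x                          ≡⟨ ℚ.+-identityʳ _ ⟨
  x ℚ.* x ℚ.+ 0ℚ                   ≤⟨ ℚ.+-monoʳ-≤ (x ℚ.* x) (0≤x² y) ⟩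
  x ℚ.* x ℚ.+ y ℚ.* y              ≡⟨ ℚ.+-identityʳ _ ⟨
  (x ℚ.* x ℚ.+ y ℚ.* y) ℚ.+ 0ℚ     ≤⟨ ℚ.+-monoʳ-≤ (x ℚ.* x ℚ.+ y ℚ.* y) (ℚ.<⇒≤ 0<δ) ⟩
  (x ℚ.* x ℚ.+ y ℚ.* y) ℚ.+ δ      ≤⟨ le ⟩
  ε ℚ.* ε                          ∎)
  where open ℚ.≤-Reasoning

⟶-unique : ∀ {u l z} → u ⟶ l → Eventually (λ n → u n ≈ z) → l ≈ z
⟶-unique {u} {l} {z} u⟶l (M , u≈z) =
  ≈-byTriangle {re l} {re z} closeRe ∧ ≈-byTriangle {im l} {im z} closeIm
  where
  closeRe : ∀ ε → 0ℚ ℚ.< ε → Eventually λ n →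
            ℚ.∣ seq (re l) n ℚ.- seq (re z) n ∣ ℚ.≤ ½ ℚ.* ε ℚ.+ ½ ℚ.* ε
  closeRe ε 0<ε =
    let N , f = u⟶l (½ ℚ.* ε) (½-pos 0<ε)
        -- One term `u k` suffices: it is late enough both to equal `z` and to be within half of `ε`
        -- of `l`.
        k = M ℕ.⊔ N
        δ , 0<δ , near = f k (ℕ.m≤n⊔m M N)
        K , g = both near (_≈_.re≈ (u≈z k (ℕ.m≤m⊔n M N)) (½ ℚ.* ε) (½-pos 0<ε))
    in K , λ n le → ℚ.≤-trans (triangle (seq (re l) n) (seq (re (u k)) n) (seq (re z) n))
         (ℚ.+-mono-≤
           (ℚ.≤-trans (ℚ.≤-reflexive (∣-∣-sym (seq (re l) n) (seq (re (u k)) n)))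
                      (∣x∣≤√ {y = seq (im (u k - l)) n} (½-pos 0<ε) 0<δ (proj₁ (g n le))))
           (proj₂ (g n le)))
  closeIm : ∀ ε → 0ℚ ℚ.< ε → Eventually λ n →
            ℚ.∣ seq (im l) n ℚ.- seq (im z) n ∣ ℚ.≤ ½ ℚ.* ε ℚ.+ ½ ℚ.* ε
  closeIm ε 0<ε =
    let N , f = u⟶l (½ ℚ.* ε) (½-pos 0<ε)
        k = M ℕ.⊔ N
        δ , 0<δ , near = f k (ℕ.m≤n⊔m M N)
        K , g = both near (_≈_.im≈ (u≈z k (ℕ.m≤m⊔n M N)) (½ ℚ.* ε) (½-pos 0<ε))
    in K , λ n le → ℚ.≤-trans (triangle (seq (im l) n) (seq (im (u k)) n) (seq (im z) n))
         (ℚ.+-mono-≤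
           (ℚ.≤-trans (ℚ.≤-reflexive (∣-∣-sym (seq (im l) n) (seq (im (u k)) n)))
                      (∣x∣≤√ {y = seq (re (u k - l)) n} (½-pos 0<ε) 0<δ
                        -- `∣x∣≤√` bounds the first summand, so the squares are swapped.
                        (ℚ.≤-trans (ℚ.≤-reflexive (cong (ℚ._+ δ)
                          (ℚ.+-comm (seq (im (u k - l)) n ℚ.* seq (im (u k - l)) n) _)))
                        (proj₁ (g n le)))))
           (proj₂ (g n le)))

-- Zero factors in products, sums and partial expressions.

*-vanishˡ : ∀ {z} w → z ≈ 0ℂ → z * w ≈ 0ℂ
*-vanishˡ {z} w e = C.trans {z * w} {0ℂ * w} (C.*-congʳ {w} {z} {0ℂ} e) (C.zeroˡ w)

*-vanishʳ : ∀ z {w} → w ≈ 0ℂ → z * w ≈ 0ℂ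
*-vanishʳ z {w} e = C.trans {z * w} {z * 0ℂ} (C.*-congˡ {z} {w} {0ℂ} e) (C.zeroʳ z)

∏<-vanish : ∀ {n} f {k} → k ℕ.< n → f k ≈ 0ℂ → ∏< n f ≈ 0ℂ
∏<-vanish {suc n} f {k} k<1+n e with ℕ.m≤n⇒m<n∨m≡n (ℕ.≤-pred k<1+n)
... | inj₁ k<n  = *-vanishˡ (f n) (∏<-vanish f k<n e)
... | inj₂ refl = *-vanishʳ (∏< n f) e

-- Ranging over all proofs of definedness makes the claim independent of the inverses chosen for the
-- denominators.
Vanishes : Partial → Set
Vanishes x = ∀ d → val x d ≈ 0ℂ

⊗-vanishˡ : ∀ {x y} → Vanishes x → Vanishes (x ⊗ y)
⊗-vanishˡ {y = y} x≈0 (d , e) = *-vanishˡ (val y e) (x≈0 d)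

⊗-vanishʳ : ∀ {x y} → Vanishes y → Vanishes (x ⊗ y)
⊗-vanishʳ {x = x} y≈0 (d , e) = *-vanishʳ (val x d) (y≈0 e)

⊗-vanish : ∀ {x y} → Vanishes x ⊎ Vanishes y → Vanishes (x ⊗ y)
⊗-vanish {x} {y} (inj₁ x≈0) = ⊗-vanishˡ {x} {y} x≈0
⊗-vanish {x} {y} (inj₂ y≈0) = ⊗-vanishʳ {x} {y} y≈0

∑-vanish : ∀ {A : Set} (xs : List A) {f} → (∀ x → Vanishes (f x)) → Vanishes (∑ xs f)
∑-vanish []       f≈0 _       = C.refl {0ℂ}
∑-vanish (x ∷ xs) {f} f≈0 (d , e) = C.trans {val (f x) d + val (∑ xs f) e} {0ℂ + 0ℂ}
  (C.+-cong {val (f x) d} {0ℂ} {val (∑ xs f) e} {0ℂ} (f≈0 x d) (∑-vanish xs f≈0 e))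
  (C.+-identityˡ 0ℂ)

if-vanish : ∀ {A : Set} (a? : Dec A) {x} → (A → Vanishes x) →
            Vanishes (if does a? then x else pure 0ℂ)
if-vanish (yes a) x≈0   = x≈0 a
if-vanish (no _)  x≈0 _ = C.refl {0ℂ}

-- Parts and interlacing.

part>0⇒< : ∀ {n m} (lam : Vec ℕ n) k → m ℕ.< part lam (suc k) → k ℕ.< n
part>0⇒< (x ∷ lam) zero    _ = z<s
part>0⇒< (x ∷ lam) (suc k) l = s<s (part>0⇒< lam k l)

part-lookup : ∀ {n} (lam : Vec ℕ n) i → part lam (suc (toℕ i)) ≡ Vec.lookup lam i
part-lookup (x ∷ lam) zero    = refl
part-lookup (x ∷ lam) (suc i) = part-lookup lam i

part-replicate : ∀ n k → part (Vec.replicate n 0) k ≡ 0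
part-replicate zero    _             = refl
part-replicate (suc n) zero          = refl
part-replicate (suc n) (suc zero)    = refl
part-replicate (suc n) (suc (suc k)) = part-replicate n (suc k)

interlacing-< : ∀ {n m} {lam μ : Vec ℕ n} → Interlacing lam μ → ∀ k →
                m ℕ.< part lam (suc (suc k)) → m ℕ.< part μ (suc k)
interlacing-< {n} {m} {lam} {μ} il k m<λ = ℕ.<-≤-trans m<λ
  (subst (λ k → part lam (suc (suc k)) ℕ.≤ part μ (suc k)) (toℕ-fromℕ< k<n)
    (proj₂ (il (fromℕ< k<n))))
  where
  k<n : k ℕ.< n
  -- Parts beyond the last are 0, so the part exceeding `m` has a genuine index.
  k<n = ℕ.<-trans (ℕ.n<1+n k) (part>0⇒< lam (suc k) m<λ)

-- One step of the chain: either `r` separates the first parts of `ν` and `lam`, or a violation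
-- survives in `ν` against the remaining exponents. The first alternative is an implication so that
-- it also covers a failure of interlacing, where `W₁` is 0 by definition.
crossing : ∀ {ℓ n r} {rs : Vec ℕ (suc ℓ)} → Linked ℕ._≥_ (r ∷ rs) → ∀ (lam ν : Vec ℕ n) i →
           Vec.lookup (r ∷ rs) i ℕ.< part lam (suc (toℕ i)) →
           (Interlacing lam ν → part ν 1 ℕ.≤ r × r ℕ.< part lam 1)
           ⊎ (∃[ j ] Vec.lookup rs j ℕ.< part ν (suc (toℕ j)))
crossing {r = r} {_ ∷ _} (r≥r′ ∷ _) lam ν zero r<λ₁ with part ν 1 ℕ.≤? r
... | yes ν₁≤r = inj₁ λ _ → ν₁≤r , r<λ₁
-- A violation in the first row stays there, because the next exponent is at most `r`; a lower one
-- moves up a row.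
... | no  ν₁≰r = inj₂ (zero , ℕ.≤-<-trans r≥r′ (ℕ.≰⇒> ν₁≰r))
crossing _ lam ν (suc i) r<λ with interlacing? lam ν
... | yes il = inj₂ (i , interlacing-< {lam = lam} {ν} il (toℕ i) r<λ)
... | no ¬il = inj₁ λ il → contradiction il ¬il

^ℤ-cancel : ∀ t m → value (t ^ℤ (ℤ.+ m)) * value (t ^ℤ (ℤ.- (ℤ.+ m))) ≈ 1ℂ
^ℤ-cancel t zero    = C.*-identityˡ 1ℂ
^ℤ-cancel t (suc m) = proj₂ (proj₂ (invertible (t ^ℕ suc m)))

-- Zeros of `E` and of the one-variable functions.

module _ (p : ℂ) (∣p∣<1 : ∣ p ∣² Real.< Real.1ℝ) (q t : ℂˣ) where
  open InfinitePochhammer p ∣p∣<1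
  open Elliptic p ∣p∣<1 q t

  [≈1]∞ : ∀ {x} → x ≈ 1ℂ → [ x ]∞ ≈ 0ℂ
  [≈1]∞ {x} x≈1 = ⟶-unique {partialProduct x} (partialProduct⟶ x)
    -- The factor with index 0 is 1 - x; the empty product is 1, so vanishing starts at index 1.
    (1 , λ n 1≤n → ∏<-vanish (λ k → 1ℂ - x * p ^ k) {0} 1≤n first)
    where
    first : 1ℂ - x * 1ℂ ≈ 0ℂ
    first = C.trans {1ℂ + (- (x * 1ℂ))} {1ℂ + (- 1ℂ)}
      (C.+-congˡ {1ℂ} {(- (x * 1ℂ))} {(- 1ℂ)} (C.-‿cong {x * 1ℂ} {1ℂ}
        (C.trans {x * 1ℂ} {x} {1ℂ} (C.*-identityʳ x) x≈1)))
      (C.-‿inverseʳ 1ℂ)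

  E-vanish : ∀ x → value x ≈ 1ℂ → E x ≈ 0ℂ
  E-vanish x x≈1 = *-vanishˡ {[ value x ]∞} [ p * value (x ⁻¹) ]∞ ([≈1]∞ {value x} x≈1)

  pochRatio-vanish : ∀ {n} a (lam μ : Vec ℕ n) {i k} → i ℕ.< n →
                     k ℕ.< part lam (suc i) ℕ.∸ part μ (suc i) →
                     E (a · t ^ℤ (ℤ.- (ℤ.+ i)) · q ^ℤ (ℤ.+ (part μ (suc i) ℕ.+ k))) ≈ 0ℂ →
                     pochRatio a lam μ ≈ 0ℂ
  pochRatio-vanish {n} a lam μ {i} {k} i<n k<λ∸μ e =
    ∏<-vanish {n} (λ i → ∏< (part lam (suc i) ℕ.∸ part μ (suc i)) (factor i)) {i} i<n
      (∏<-vanish {part lam (suc i) ℕ.∸ part μ (suc i)} (factor i) {k} k<λ∸μ e)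
    where
    factor : ℕ → ℕ → ℂ
    factor i k = E (a · t ^ℤ (ℤ.- (ℤ.+ i)) · q ^ℤ (ℤ.+ (part μ (suc i) ℕ.+ k)))

  -- The first row of the ratio runs through the q-exponents from the first part of `μ` up to that
  -- of `lam`, excluding the latter. Hence `r` occurs among them, and its factor is E(q^r / x) =
  -- E(1).
  pochRatio-vanish-at-q^r : ∀ {n} r x (lam μ : Vec ℕ n) → value x ≈ value (q ^ℕ r) →
                            part μ 1 ℕ.≤ r → r ℕ.< part lam 1 → pochRatio (x ⁻¹) lam μ ≈ 0ℂ
  pochRatio-vanish-at-q^r {n} r x lam μ x≈q^r μ₁≤r r<λ₁ =
    pochRatio-vanish (x ⁻¹) lam μ {0} {k} (part>0⇒< lam 0 r<λ₁) (ℕ.∸-monoˡ-< r<λ₁ μ₁≤r)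
      (E-vanish (x ⁻¹ · t ^ℤ (ℤ.- (ℤ.+ 0)) · q ^ℤ (ℤ.+ (part μ (suc 0) ℕ.+ k))) argument≈1)
    where
    open import Relation.Binary.Reasoning.Setoid C.setoid
    k : ℕ
    k = r ℕ.∸ part μ 1
    argument≈1 : value (x ⁻¹ · t ^ℤ (ℤ.- (ℤ.+ 0)) · q ^ℤ (ℤ.+ (part μ (suc 0) ℕ.+ k))) ≈ 1ℂ
    argument≈1 rewrite ℕ.m+[n∸m]≡n μ₁≤r = begin
      value (x ⁻¹) * 1ℂ * value (q ^ℕ r)  ≈⟨ C.*-congʳ {value (q ^ℕ r)} {value (x ⁻¹) * 1ℂ} {value (x ⁻¹)}
                                               (C.*-identityʳ (value (x ⁻¹))) ⟩
      value (x ⁻¹) * value (q ^ℕ r)       ≈⟨ C.*-congˡ {value (x ⁻¹)} {value x} {value (q ^ℕ r)} x≈q^r ⟨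
      value (x ⁻¹) * value x              ≈⟨ proj₁ (proj₂ (invertible x)) ⟩
      1ℂ                                  ∎

  W₁-interlaced-vanish : ∀ {n} r x (lam μ : Vec ℕ n) {a b} → value x ≈ value (q ^ℕ r) →
                         part μ 1 ℕ.≤ r → r ℕ.< part lam 1 → Vanishes (W₁-interlaced lam μ b x a)
  W₁-interlaced-vanish {n} r x lam μ {a} {b} x≈q^r μ₁≤r r<λ₁ =
    -- The last factor of W₁-interlaced is a product over i ≤ n; spelling out only its
    -- shape as a fold suffices to determine it.
    ⊗-vanishˡ {H lam μ b ⊗ R ⊗ S} {List.foldr _ (pure 1ℂ) (List.upTo n)}
      (⊗-vanishˡ {H lam μ b ⊗ R} {S} (⊗-vanishʳ {H lam μ b} {R}
        (⊗-vanishˡ {pure (pochRatio (x ⁻¹) lam μ)} {pure (pochRatio (a · x) lam μ)}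
          λ _ → pochRatio-vanish-at-q^r r x lam μ x≈q^r μ₁≤r r<λ₁)))
    where
    R S : Partial
    R = pure (pochRatio (x ⁻¹) lam μ) ⊗ pure (pochRatio (a · x) lam μ)
    S = (pure (pochλ (q · b · x · t ⁻¹) μ) ⊗ pure (pochλ (q · b · (a · x · t) ⁻¹) μ))
        ⊘ (pure (pochλ (q · b · x) lam) ⊗ pure (pochλ (q · b · (a · x) ⁻¹) lam))

  W₁-vanish : ∀ {n} r x (lam μ : Vec ℕ n) {a b} → value x ≈ value (q ^ℕ r) →
              (Interlacing lam μ → part μ 1 ℕ.≤ r × r ℕ.< part lam 1) →
              Vanishes (W₁ lam μ b x a)
  W₁-vanish r x lam μ {a} {b} x≈q^r h = if-vanish (interlacing? lam μ) {W₁-interlaced lam μ b x a} λ il →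
    W₁-interlaced-vanish r x lam μ {a} {b} x≈q^r (proj₁ (h il)) (proj₂ (h il))

  -- Specialised variables and the branching recursion.

  q^st^k : ∀ {s r k} → s ≡ r → k ≡ 0 → value (q ^ℤ (ℤ.+ s) · t ^ℤ (ℤ.+ k)) ≈ value (q ^ℤ (ℤ.+ r))
  q^st^k {s} refl refl = C.*-identityʳ (value (q ^ℤ (ℤ.+ s)))

  q^st^k·t^-m : ∀ {s r k m} → s ≡ r → k ≡ m →
                value (q ^ℤ (ℤ.+ s) · t ^ℤ (ℤ.+ k) · t ^ℤ (ℤ.- (ℤ.+ m))) ≈ value (q ^ℤ (ℤ.+ r))
  q^st^k·t^-m {r} {m = m} refl refl = begin
    Q * T * T⁻    ≈⟨ C.*-assoc Q T T⁻ ⟩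
    Q * (T * T⁻)  ≈⟨ C.*-congˡ {Q} {T * T⁻} {1ℂ} (^ℤ-cancel t m) ⟩
    Q * 1ℂ        ≈⟨ C.*-identityʳ Q ⟩
    Q             ∎
    where
    open import Relation.Binary.Reasoning.Setoid C.setoid
    Q  = value (q ^ℤ (ℤ.+ r))
    T  = value (t ^ℤ (ℤ.+ m))
    T⁻ = value (t ^ℤ (ℤ.- (ℤ.+ m)))

  -- The branching rule evaluates W₁ at the first variable times t^{-ℓ}, where ℓ is the
  -- number of remaining variables.
  data Specialised : ∀ {ℓ} → Vec ℂˣ (suc ℓ) → Vec ℕ (suc ℓ) → Set where
    last : ∀ {x r} → value x ≈ value (q ^ℤ (ℤ.+ r)) → Specialised (x ∷ []) (r ∷ [])
    next : ∀ {ℓ x r} {xs : Vec ℂˣ (suc ℓ)} {rs} →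
           value (x · t ^ℤ (ℤ.- (ℤ.+ suc ℓ))) ≈ value (q ^ℤ (ℤ.+ r)) →
           Specialised xs rs → Specialised (x ∷ xs) (r ∷ rs)

  -- Each summand is a product, and which factor is zero may depend on `ν`. Splitting `xs` lets
  -- `Wskew` unfold to the branching sum.
  Wskew-∷-vanish : ∀ {n ℓ} (lam μ : Vec ℕ n) x (xs : Vec ℂˣ (suc ℓ)) {a b} →
    (∀ ν → Vanishes (W₁ lam ν (b · t ^ℤ (ℤ.+ suc ℓ)) (x · t ^ℤ (ℤ.- (ℤ.+ suc ℓ))) (a · t ^ℤ (ℤ.+ 2 ℤ.* ℤ.+ suc ℓ)))
           ⊎ Vanishes (Wskew ν μ xs a b)) →
    Vanishes (Wskew lam μ (x ∷ xs) a b)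
  Wskew-∷-vanish {n} {ℓ} lam μ x (z ∷ zs) {a} {b} h =
    ∑-vanish (interlacedBy lam) {λ ν → first ν ⊗ rest ν} λ ν → ⊗-vanish {first ν} {rest ν} (h ν)
    where
    first rest : Vec ℕ n → Partial
    first ν = W₁ lam ν (b · t ^ℤ (ℤ.+ suc ℓ)) (x · t ^ℤ (ℤ.- (ℤ.+ suc ℓ))) (a · t ^ℤ (ℤ.+ 2 ℤ.* ℤ.+ suc ℓ))
    rest ν = Wskew ν μ (z ∷ zs) a b

  -- Induction on the variables, with `lam` and `i` varying: by `crossing`, the one-variable factor
  -- is zero or `ν` inherits a violated index.
  Wskew-vanish : ∀ {n ℓ} {xs : Vec ℂˣ (suc ℓ)} {rs} → Specialised xs rs → Linked ℕ._≥_ rs →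
                 ∀ (lam : Vec ℕ n) i → Vec.lookup rs i ℕ.< part lam (suc (toℕ i)) →
                 ∀ {a b} → Vanishes (Wskew lam (Vec.replicate n 0) xs a b)
  Wskew-vanish {n} (last {x} {r} x≈q^r) _ lam zero r<λ₁ {a} {b} =
    -- The chain ends at the zero partition, so with one variable left the crossing is forced.
    W₁-vanish r x lam (Vec.replicate n 0) {a} {b} x≈q^r λ _ →
      subst (ℕ._≤ r) (sym (part-replicate n 1)) ℕ.z≤n , r<λ₁
  Wskew-vanish {n} (next {ℓ} {x} {r} {xs} x≈q^r s) dec lam i r<λ {a} {b} =
    Wskew-∷-vanish {n} {ℓ} lam (Vec.replicate n 0) x xs {a} {b} λ ν → Sum.map
      (W₁-vanish r (x · t ^ℤ (ℤ.- (ℤ.+ suc ℓ))) lam ν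
        {a · t ^ℤ (ℤ.+ 2 ℤ.* ℤ.+ suc ℓ)} {b · t ^ℤ (ℤ.+ suc ℓ)} x≈q^r)
      (λ (j , r<ν) → Wskew-vanish s (Linked.tail dec) ν j r<ν {a} {b})
      (crossing dec lam ν i r<λ)

  -- ρ and κ are kept apart from rs and ℓ so that the recursion compares exponents in ℕ
  -- instead of complex numbers.
  specialised : ∀ {ℓ} (rs : Vec ℕ (suc ℓ)) (ρ κ : Fin (suc ℓ) → ℕ) →
                (∀ i → ρ i ≡ Vec.lookup rs i) → (∀ i → κ i ≡ suc ℓ ℕ.∸ suc (toℕ i)) →
                Specialised (Vec.tabulate λ i → q ^ℤ (ℤ.+ ρ i) · t ^ℤ (ℤ.+ κ i)) rs
  specialised (r ∷ []) ρ κ ρ≡ κ≡ =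
    last {q ^ℤ (ℤ.+ ρ zero) · t ^ℤ (ℤ.+ κ zero)} {r} (q^st^k {ρ zero} {r} {κ zero} (ρ≡ zero) (κ≡ zero))
  specialised {suc ℓ} (r ∷ rs@(_ ∷ _)) ρ κ ρ≡ κ≡ =
    next {ℓ} {q ^ℤ (ℤ.+ ρ zero) · t ^ℤ (ℤ.+ κ zero)} {r}
      (q^st^k·t^-m {ρ zero} {r} {κ zero} {suc ℓ} (ρ≡ zero) (κ≡ zero))
      (specialised rs (λ i → ρ (suc i)) (λ i → κ (suc i)) (λ i → ρ≡ (suc i)) (λ i → κ≡ (suc i)))

mainTheorem5 : (p : ℂ) (∣p∣<1 : ∣ p ∣² Real.< Real.1ℝ) (q t a b : ℂˣ) →
    let open Elliptic p ∣p∣<1 q t in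
    (m : ℕ) (π lam : Partition (suc m)) → ¬ (lam ⊆ π) →
    (generic : Defined (W lam (q^ π t^δ) a b)) →
    val (W lam (q^ π t^δ) a b) generic ≈ 0ℂ
mainTheorem5 p ∣p∣<1 q t a b m π lam lam⊈π =
  -- Comparison of parts is decidable and the index set finite, so failure of containment yields an
  -- explicit row.
  let i , λᵢ≰πᵢ = ¬∀⟶∃¬ (suc m) _ (λ i → Vec.lookup (parts lam) i ℕ.≤? Vec.lookup (parts π) i) lam⊈π
  in Wskew-vanish p ∣p∣<1 q t
       (specialised p ∣p∣<1 q t (parts π) (Vec.lookup (parts π)) _ (λ _ → refl) (λ _ → refl))
       (decreasing π) (parts lam) i
       (subst (Vec.lookup (parts π) i ℕ.<_) (sym (part-lookup (parts lam) i)) (ℕ.≰⇒> λᵢ≰πᵢ)) {a} {b}
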